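{- Let $G=(V,E)$ be a bipartite graph of diameter $D$, let $G'=(V',E')$ be a subgraph of $G$ (i.e., $V'\subseteq V$ and $E'\subseteq E$), and let $k\ge 1$ be an integer parameter. Assume that $M$ is a matching of $G'$ such that there exists no augmenting path of length at most $2k-1$ with respect to $M$ in $G'$. Then there exists a deterministic $\mathsf{CONGEST}$ model algorithm that computes a $(1+1/k)$-approximate minimum vertex cover of $G'$ in $O(D+k)$ rounds on the graph $G$.
   Context: $\mathsf{CONGEST}$ model on $G$: the network is the $n$-node undirected graph $G$, and each node has a unique $O(\log n)$-bit identifier. Computation proceeds in synchronous communication rounds. In each round every node can perform local computations and send one $O(\log n)$-bit message to each of its neighbors in $G$. The time complexity is the number of rounds. At the end each node must know its own part of the output (here: whether it is in the vertex cover). Input: each node of $G$ knows whether it is contained in $V'$, which of its incident edges are contained in $E'$, and which of its incident edges are in the given matching $M$. An augmenting path with respect to a matching $M$ in a graph is a path that starts and ends with unmatched vertices and alternates between unmatched and matched edges with respect to $M$. Its length is its number of edges. A vertex cover of $G'$ is a set of nodes of $G'$ containing at least one endpoint of every edge of $G'$. It is $\rho$-approximate if its size is at most $\rho$ times the minimum size of a vertex cover of $G'$. -}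

module Defs where

open import Data.Bool using (Bool; true; false; T)
open import Data.Fin using (Fin)
open import Data.Fin.Subset using (Subset; _∈_; _⊆_; ∣_∣)
open import Data.Integer using (+_)
open import Data.List using (List; []; _∷_; length)
open import Data.List.Relation.Unary.Linked using (Linked)
open import Data.List.Relation.Unary.Unique.Propositional using (Unique)
open import Data.Maybe using (Maybe; just)
open import Data.Nat using (ℕ; zero; suc; _*_; _^_; _≤_; _<_)
open import Data.Nat.Logarithm using (⌈log₂_⌉)
open import Data.Product using (Σ; ∃; ∃-syntax; _×_; _,_; proj₁; proj₂)
open import Data.Rational as ℚ using (ℚ; _/_)
open import Data.Sum using (_⊎_)
open import Data.Vec using (lookup)
open import Function.Bundles using (_↔_; Inverse)
open import Function.Definitions using (Injective)
open import Relation.Binary.PropositionalEquality using (_≡_; _≢_; subst)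
open import Relation.Nullary using (¬_)

------------------------------------------------------------------------
-- Graphs

-- A finite simple undirected graph on the node set Fin n is its edge set.

record EdgeSet (n : ℕ) : Set where
  field
    has       : Fin n → Fin n → Bool
    symmetric : ∀ u v → has u v ≡ has v u
    loopless  : ∀ v → has v v ≡ false

open EdgeSet public

Graph : ℕ → Set
Graph = EdgeSet

module _ {n : ℕ} where

  Adj : EdgeSet n → Fin n → Fin n → Set
  Adj E u v = T (has E u v)

  Adj-sym : (E : EdgeSet n) → ∀ {u v} → Adj E u v → Adj E v u
  Adj-sym E {u} {v} = subst T (symmetric E u v)

  _⊆ₑ_ : EdgeSet n → EdgeSet n → Set
  E ⊆ₑ F = ∀ u v → Adj E u v → Adj F u v

  Bipartite : Graph n → Set
  Bipartite G = Σ (Fin n → Bool) λ side → ∀ u v → Adj G u v → side u ≢ side v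

  infixr 5 _∷_

  data Walk (E : EdgeSet n) : Fin n → Fin n → ℕ → Set where
    []  : ∀ {v} → Walk E v v zero
    _∷_ : ∀ {u v w ℓ} → Adj E u v → Walk E v w ℓ → Walk E u w (suc ℓ)

  vertices : ∀ {E : EdgeSet n} {u v ℓ} → Walk E u v ℓ → List (Fin n)
  vertices {u = u} []      = u ∷ []
  vertices {u = u} (_ ∷ w) = u ∷ vertices w

  Distance : Graph n → Fin n → Fin n → ℕ → Set
  Distance G u v d = Walk G u v d × (∀ ℓ → Walk G u v ℓ → d ≤ ℓ)

  -- The maximum distance over all pairs of nodes. Since every pair must have
  -- a distance, a graph with a diameter is connected (and nonempty).

  Diameter : Graph n → ℕ → Set
  Diameter G D = (∀ u v → ∃[ d ] Distance G u v d × d ≤ D)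
               × (∃[ u ] ∃[ v ] Distance G u v D)

record Subgraph {n : ℕ} (G : Graph n) : Set where
  field
    nodes     : Subset n
    edges     : EdgeSet n
    edges⊆    : edges ⊆ₑ G
    endpoints : ∀ u v → Adj edges u v → u ∈ nodes

open Subgraph public

module _ {n : ℕ} {G : Graph n} (G′ : Subgraph G) where

  IsMatching : EdgeSet n → Set
  IsMatching M = (M ⊆ₑ edges G′)
               × (∀ u v w → Adj M u v → Adj M u w → v ≡ w)

  IsVertexCover : Subset n → Set
  IsVertexCover S = (S ⊆ nodes G′)
                  × (∀ u v → Adj (edges G′) u v → u ∈ S ⊎ v ∈ S)

  IsMinimumVertexCover : Subset n → Set
  IsMinimumVertexCover S =
    IsVertexCover S × (∀ S′ → IsVertexCover S′ → ∣ S ∣ ≤ ∣ S′ ∣)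

  IsApproximateVertexCover : ℚ → Subset n → Set
  IsApproximateVertexCover ρ S =
    IsVertexCover S ×
    (∀ S* → IsMinimumVertexCover S* → + ∣ S ∣ / 1 ℚ.≤ ρ ℚ.* (+ ∣ S* ∣ / 1))

module _ {n : ℕ} (M : EdgeSet n) where

  Unmatched : Fin n → Set
  Unmatched v = ∀ u → ¬ Adj M v u

  matchedFlags : ∀ {E : EdgeSet n} {u v ℓ} → Walk E u v ℓ → List Bool
  matchedFlags []                        = []
  matchedFlags (_∷_ {u = u} {v = v} _ w) = has M u v ∷ matchedFlags w

  -- The length is required to be positive: a single unmatched node is not
  -- an augmenting path.

  record AugmentingPath (E : EdgeSet n) (ℓ : ℕ) : Set where
    field
      {start end}     : Fin n
      walk            : Walk E start end ℓ
      nonempty        : 1 ≤ ℓ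
      simple          : Unique (vertices walk)
      start-unmatched : Unmatched start
      end-unmatched   : Unmatched end
      alternating     : Linked _≢_ (matchedFlags walk)

------------------------------------------------------------------------
-- The CONGEST model

-- A node of degree d addresses its incident edges by local ports Fin d, and
-- does not initially know which node is at the other end of a port. The
-- bijection is with the neighbours because Adj is proof-irrelevant.

record Ports {n : ℕ} (G : Graph n) : Set where
  field
    degree : Fin n → ℕ
    port   : ∀ v → Fin (degree v) ↔ ∃ (Adj G v)

  neighbour : ∀ v → Fin (degree v) → Fin n
  neighbour v p = proj₁ (Inverse.to (port v) p)

  -- The port at which the neighbour sees the same edge.

  reverse : ∀ v (p : Fin (degree v)) → Fin (degree (neighbour v p))
  reverse v p = Inverse.from (port (neighbour v p))
                  (v , Adj-sym G (proj₂ (Inverse.to (port v) p)))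

-- Unique identifiers of at most c ⌈log₂ n⌉ bits.

record Identifiers (c n : ℕ) : Set where
  field
    ident     : Fin n → ℕ
    unique    : Injective _≡_ _≡_ ident
    bit-bound : ∀ v → ident v < 2 ^ (c * ⌈log₂ n ⌉)

-- Everything a node of degree d knows initially besides the global
-- parameter k; in particular neither n nor the diameter.

record NodeInput (d : ℕ) : Set where
  field
    ident : ℕ
    inV′  : Bool
    inE′  : Fin d → Bool
    inM   : Fin d → Bool

nodeInput : ∀ {n c} {G : Graph n} (P : Ports G) → Identifiers c n →
            Subgraph G → EdgeSet n → ∀ v → NodeInput (Ports.degree P v)
nodeInput P ids G′ M v = record
  { ident = Identifiers.ident ids v
  ; inV′  = lookup (nodes G′) v
  ; inE′  = λ p → has (edges G′) v (Ports.neighbour P v p)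
  ; inM   = λ p → has M v (Ports.neighbour P v p)
  }

-- A string of bits; the empty string stands for sending nothing.

Message : Set
Message = List Bool

-- All nodes run the same deterministic program, which depends only on the
-- degree, the parameter k and the local input. A node whose output is defined
-- has terminated: its output is final and it is silent from then on.

record Algorithm : Set₁ where
  field
    State   : ℕ → Set
    init    : ∀ {d} → ℕ → NodeInput d → State d
    send    : ∀ {d} → State d → Fin d → Message
    receive : ∀ {d} → State d → (Fin d → Message) → State d
    output  : ∀ {d} → State d → Maybe Bool

    final   : ∀ {d} (s : State d) {b} → output s ≡ just b →
              ∀ inbox → output (receive s inbox) ≡ just b
    silent  : ∀ {d} (s : State d) {b} → output s ≡ just b →
              ∀ p → send s p ≡ []

module Execution (A : Algorithm) (k : ℕ) {n : ℕ} {G : Graph n} (P : Ports G)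
                 (input : ∀ v → NodeInput (Ports.degree P v)) where

  open Algorithm A
  open Ports P

  -- The state of a node after t rounds.

  state : ℕ → ∀ v → State (degree v)
  state zero    v = init k (input v)
  state (suc t) v = receive (state t v)
    (λ p → send (state t (neighbour v p)) (reverse v p))

  MessagesBounded : ℕ → Set
  MessagesBounded bits = ∀ t v p → length (send (state t v) p) ≤ bits

  -- After t rounds all nodes have terminated, and S is the set of nodes
  -- that answered "yes".

  ComputesWithin : ℕ → Subset n → Set
  ComputesWithin t S = ∀ v → output (state t v) ≡ just (lookup S v)

{-# OPTIONS --safe #-}
module Submission where

-- Let left and right be the nodes at even and odd distance from a leader, and let r(v) be the
-- alternating distance of v from the unmatched left nodes. For every i < k, the left nodes with
-- r > 2i together with the right nodes with r ≤ 2i + 1 cover G′, and all of them are matched for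
-- want of short augmenting paths. Both ends of a matching edge are taken only if its right end
-- has ⌊r/2⌋ = i, so by averaging some i costs at most |M| (1 + 1/k) ≤ (1 + 1/k) |S*| nodes.
--
-- The nodes know neither n nor D and try the guesses T = k, 2k, 4k, ... for D. A guess is good if
-- the node of least identifier reaches every node in T rounds, which all nodes detect
-- consistently by comparing, within distance 2T + 1, the least identifiers seen within distance T.
-- Then the k layer sizes are summed up a breadth-first tree in a pipeline, which takes T + k
-- rounds, and the leader floods the best i.

open import Defs
open import Data.Bool using (Bool; true; false; T; not; _∧_; if_then_else_)
open import Data.Bool.Properties using (T?; T-≡; T-irrelevant; ¬-not; not-¬; not-involutive)
open import Data.Fin using (Fin; zero; suc)
import Data.Fin as Fin
open import Data.Fin.Permutation using (Permutation; permutation)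
import Data.Fin.Properties as Fin
open import Data.Fin.Subset using (Subset; ∣_∣; _∈_)
open import Data.Integer using (+_)
import Data.Integer as ℤ
import Data.Integer.Properties as ℤ
open import Data.List using (List; []; _∷_; length)
open import Data.List.Relation.Unary.All as All using (All; []; _∷_)
open import Data.List.Relation.Unary.AllPairs using ([]; _∷_)
open import Data.List.Relation.Unary.Linked using (Linked; []; [-]; _∷_)
open import Data.List.Relation.Unary.Unique.Propositional using (Unique)
open import Data.Maybe using (Maybe; just; nothing)
open import Data.Nat hiding (_/_)
open import Data.Nat.Binary using (ℕᵇ; 2[1+_]; 1+[2_]; fromℕ; toℕ)
open import Data.Nat.Binary.Properties using (toℕ-fromℕ)
open import Data.Nat.Induction using (<-rec)
open import Data.Nat.Logarithm using (⌈log₂_⌉; ⌈log₂⌈n/2⌉⌉≡⌈log₂n⌉∸1; ⌈log₂⌉-mono-≤)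
open import Data.Nat.Properties
open import Data.Nat.Solver using (module +-*-Solver)
open import Data.Product using (Σ; ∃; ∃-syntax; Σ-syntax; _×_; _,_; proj₁; proj₂)
open import Data.Rational as ℚ using (1ℚ; _/_)
import Data.Rational.Properties as ℚ
import Data.Rational.Unnormalised as ℚᵘ
import Data.Rational.Unnormalised.Properties as ℚᵘ
open import Data.Sum as Sum using (_⊎_; inj₁; inj₂; swap)
open import Data.Vec using (lookup; tabulate; []; _∷_)
import Data.Vec.Functional as Vector
open import Data.Vec.Properties using (lookup∘tabulate; []=⇒lookup; lookup⇒[]=)
open import Function using (_∘_; Equivalence; Inverse)
open import Relation.Binary using (tri<; tri≈; tri>)
open import Relation.Binary.PropositionalEquality
open import Relation.Nullary using (¬_; ¬?; Dec; yes; no; contradiction; does)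
open import Relation.Nullary.Decidable using (dec-true; dec-false; decidable-stable)

open import Algebra.Properties.CommutativeMonoid.Sum +-0-commutativeMonoid
  using (sum; sum-cong-≗; ∑-distrib-+; ∑-comm; sum-permute; sum-replicate-zero)
open +-*-Solver using (solve; con; _:+_; _:*_; _:=_)

-- The leader is needed for more than collecting sums: the nodes do not know the two sides of G, and
-- in a connected bipartite graph the parity of the distance from one fixed node recovers them up to
-- a swap.
--
-- The bound 2k - 1 on augmenting paths enters only on the right: an unmatched right node with r <
-- 2k would end an augmenting path of length r. On the left matchedness is free, since an unmatched
-- left node has r = 0. Hence the layer search may stop after 2k steps, and exactly k values of i
-- are available for averaging. As all nodes of the cover are matched, its size can exceed |M| only
-- through matching edges taken at both ends, while |M| is at most |S*| because disjoint edges need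
-- distinct cover nodes.
--
-- Starting with the guess k instead of 1 keeps a phase linear in T in spite of its 2k search rounds
-- and k pipelined sums. The lengths of the phases then add up geometrically, and since a guess is
-- doubled only while T < D, no guess exceeds 2D + k.

-- Bijective base 2, in which 0 is the empty string, that is, silence.

bits : ℕᵇ → Message
bits ℕᵇ.zero  = []
bits 2[1+ x ] = true ∷ bits x
bits 1+[2 x ] = false ∷ bits x

unbits : Message → ℕᵇ
unbits []           = ℕᵇ.zero
unbits (true ∷ m)  = 2[1+ unbits m ]
unbits (false ∷ m) = 1+[2 unbits m ]

unbits-bits : ∀ x → unbits (bits x) ≡ x
unbits-bits ℕᵇ.zero  = refl
unbits-bits 2[1+ x ] = cong 2[1+_] (unbits-bits x)
unbits-bits 1+[2 x ] = cong 1+[2_] (unbits-bits x)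

-- The digits are 1 and 2, so the least number with ℓ digits has only ones and equals 2^ℓ - 1.
2^length-bits : ∀ x → 2 ^ length (bits x) ≤ suc (toℕ x)
2^length-bits ℕᵇ.zero  = s≤s z≤n
2^length-bits 2[1+ x ] = ≤-trans (*-monoʳ-≤ 2 (2^length-bits x)) (n≤1+n _)
2^length-bits 1+[2 x ] =
  ≤-trans (*-monoʳ-≤ 2 (2^length-bits x)) (≤-reflexive (*-suc 2 (toℕ x)))

encode : ℕ → Message
encode = bits ∘ fromℕ

decode : Message → ℕ
decode = toℕ ∘ unbits

decode-encode : ∀ m → decode (encode m) ≡ m
decode-encode m = trans (cong toℕ (unbits-bits (fromℕ m))) (toℕ-fromℕ m)

length-encode : ∀ {m b} → m < 2 ^ b → length (encode m) ≤ b
length-encode {m} {b} m<2^b = ≮⇒≥ λ b<ℓ → <⇒≱ (^-monoʳ-< 2 ≤-refl b<ℓ) (begin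
  2 ^ length (encode m)  ≤⟨ 2^length-bits (fromℕ m) ⟩
  suc (toℕ (fromℕ m))    ≡⟨ cong suc (toℕ-fromℕ m) ⟩
  suc m                  ≤⟨ m<2^b ⟩
  2 ^ b                  ∎)
  where open ≤-Reasoning

n≤2^⌈log₂n⌉ : ∀ n → n ≤ 2 ^ ⌈log₂ n ⌉
n≤2^⌈log₂n⌉ = <-rec _ go
  where
  go : ∀ n → (∀ {m} → m < n → m ≤ 2 ^ ⌈log₂ m ⌉) → n ≤ 2 ^ ⌈log₂ n ⌉
  go 0             _  = z≤n
  go 1             _  = s≤s z≤n
  go n@(suc (suc m)) ih = begin
    n                              ≡⟨ ⌊n/2⌋+⌈n/2⌉≡n n ⟨
    ⌊ n /2⌋ + ⌈ n /2⌉              ≤⟨ +-monoˡ-≤ ⌈ n /2⌉ (⌊n/2⌋≤⌈n/2⌉ n) ⟩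
    ⌈ n /2⌉ + ⌈ n /2⌉              ≡⟨ cong (λ h → ⌈ n /2⌉ + h) (+-identityʳ _) ⟨
    2 * ⌈ n /2⌉                    ≤⟨ *-monoʳ-≤ 2 (ih (⌈n/2⌉<n m)) ⟩
    2 ^ suc ⌈log₂ ⌈ n /2⌉ ⌉        ≡⟨ cong (λ e → 2 ^ suc e) (⌈log₂⌈n/2⌉⌉≡⌈log₂n⌉∸1 n) ⟩
    2 ^ suc (⌈log₂ n ⌉ ∸ 1)        ≡⟨ cong (2 ^_) (m+[n∸m]≡n {1} (⌈log₂⌉-mono-≤ {2} {n} (s≤s (s≤s z≤n)))) ⟩
    2 ^ ⌈log₂ n ⌉                  ∎
    where open ≤-Reasoning

-- Synchronous programs

-- A free monad over one communication round: the phases are composed sequentially in it, and the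
-- state machine that `Algorithm` demands is derived once, in `repeatPhases`.
data Prog (d : ℕ) (X : Set) : Set where
  return : X → Prog d X
  round  : (Fin d → ℕ) → ((Fin d → ℕ) → Prog d X) → Prog d X

infixl 1 _>>=_

_>>=_ : ∀ {d X Y} → Prog d X → (X → Prog d Y) → Prog d Y
return x  >>= g = g x
round s f >>= g = round s (λ inbox → f inbox >>= g)

iterate : ∀ {d X} → (ℕ → X → Fin d → ℕ) → (ℕ → X → (Fin d → ℕ) → X) →
          ℕ → ℕ → X → Prog d X
iterate snd rcv s zero    x = return x
iterate snd rcv s (suc L) x =
  round (snd s x) (λ inbox → iterate snd rcv (suc s) L (rcv s x inbox))

record NodeState (d : ℕ) : Set where
  constructor node
  field
    phase   : ℕ → Prog d (Maybe Bool)
    guess   : ℕ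
    current : Prog d (Maybe Bool)

-- `return nothing` stands for a failed guess; one silent round then doubles it. `return (just b)`
-- is absorbing, which is all that `final` and `silent` need.
repeatPhases : (∀ {d} → ℕ → NodeInput d → ℕ → Prog d (Maybe Bool)) → Algorithm
repeatPhases phase = record
  { State   = NodeState
  ; init    = λ k i → node (phase k i) k (phase k i k)
  ; send    = send
  ; receive = receive
  ; output  = output
  ; final   = final
  ; silent  = silent
  }
  where
  send : ∀ {d} → NodeState d → Fin d → Message
  send (node _ _ (return _))  p = []
  send (node _ _ (round s _)) p = encode (s p)

  receive : ∀ {d} → NodeState d → (Fin d → Message) → NodeState d
  receive (node ph g (return (just b))) _     = node ph g (return (just b))
  receive (node ph g (return nothing))  _     = node ph (2 * g) (ph (2 * g))
  receive (node ph g (round _ f))       inbox = node ph g (f (decode ∘ inbox))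

  output : ∀ {d} → NodeState d → Maybe Bool
  output (node _ _ (return a))  = a
  output (node _ _ (round _ _)) = nothing

  final : ∀ {d} (s : NodeState d) {b} → output s ≡ just b →
          ∀ inbox → output (receive s inbox) ≡ just b
  final (node _ _ (return (just _))) eq _ = eq

  silent : ∀ {d} (s : NodeState d) {b} → output s ≡ just b →
           ∀ p → send s p ≡ []
  silent (node _ _ (return (just _))) _ _ = refl

-- Specifications of programs run by all nodes together

module Network {n : ℕ} {G : Graph n} (P : Ports G) (bound : ℕ) where
  open Ports P

  -- Inboxes are only constrained pointwise, for want of function extensionality.

  Achieves : {X : Fin n → Set} → ℕ → (∀ v → Prog (degree v) (X v)) →
             ((∀ v → X v) → Set) → Set
  Achieves {X} zero ps Q = Σ (∀ v → X v) λ x → (∀ v → ps v ≡ return (x v)) × Q x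
  Achieves {X} (suc t) ps Q =
    Σ (∀ v → Fin (degree v) → ℕ) λ s →
    Σ (∀ v → (Fin (degree v) → ℕ) → Prog (degree v) (X v)) λ f →
    (∀ v → ps v ≡ round (s v) (f v)) ×
    (∀ v p → s v p < bound) ×
    (∀ (inbox : ∀ v → Fin (degree v) → ℕ) →
     (∀ v p → inbox v p ≡ s (neighbour v p) (reverse v p)) →
     Achieves t (λ v → f v (inbox v)) Q)

  module _ {X : Fin n → Set} where

    achieves-cong : ∀ t {ps qs : ∀ v → Prog (degree v) (X v)} {Q : (∀ v → X v) → Set} →
                    (∀ v → ps v ≡ qs v) → Achieves t qs Q → Achieves t ps Q
    achieves-cong zero    eq (x , e , q)     = x , (λ v → trans (eq v) (e v)) , q
    achieves-cong (suc t) eq (s , f , e , r) = s , f , (λ v → trans (eq v) (e v)) , r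

    achieves-weaken : ∀ t {ps : ∀ v → Prog (degree v) (X v)} {Q R : (∀ v → X v) → Set} →
                      (∀ x → Q x → R x) → Achieves t ps Q → Achieves t ps R
    achieves-weaken zero    w (x , e , q) = x , e , w x q
    achieves-weaken (suc t) w (s , f , e , b , k) =
      s , f , e , b , λ inbox eq → achieves-weaken t w (k inbox eq)

    achieves-return : {Q : (∀ v → X v) → Set} (x : ∀ v → X v) → Q x →
                      Achieves 0 (λ v → return (x v)) Q
    achieves-return x q = x , (λ _ → refl) , q

  achieves->>= : ∀ {X Y : Fin n → Set} t t′ {ps : ∀ v → Prog (degree v) (X v)}
    {g : ∀ v → X v → Prog (degree v) (Y v)}
    {Q : (∀ v → X v) → Set} {R : (∀ v → Y v) → Set} →
    Achieves t ps Q → (∀ x → Q x → Achieves t′ (λ v → g v (x v)) R) →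
    Achieves (t + t′) (λ v → ps v >>= g v) R
  achieves->>= zero t′ {g = g} (x , e , q) h =
    achieves-cong t′ (λ v → cong (_>>= g v) (e v)) (h x q)
  achieves->>= (suc t) t′ {g = g} (s , f , e , b , k) h =
    s , (λ v inbox → f v inbox >>= g v) , (λ v → cong (_>>= g v) (e v)) , b ,
    λ inbox eq → achieves->>= t t′ (k inbox eq) h

  achieves-iterate : ∀ {X : Fin n → Set}
    {snd : ∀ v → ℕ → X v → Fin (degree v) → ℕ}
    {rcv : ∀ v → ℕ → X v → (Fin (degree v) → ℕ) → X v}
    (Inv : ℕ → (∀ v → X v) → Set) →
    (∀ s x → Inv s x → ∀ v p → snd v s (x v) p < bound) →
    (∀ s x → Inv s x → (inbox : ∀ v → Fin (degree v) → ℕ) →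
     (∀ v p → inbox v p ≡ snd (neighbour v p) s (x (neighbour v p)) (reverse v p)) →
     Inv (suc s) (λ v → rcv v s (x v) (inbox v))) →
    ∀ L (x : ∀ v → X v) → Inv 0 x →
    Achieves L (λ v → iterate (snd v) (rcv v) 0 L (x v)) (Inv L)
  achieves-iterate {X} {snd} {rcv} Inv bounded step = from 0
    where
    from : ∀ s L x → Inv s x →
           Achieves L (λ v → iterate (snd v) (rcv v) s L (x v)) (Inv (s + L))
    from s zero x inv =
      x , (λ _ → refl) , subst (λ t → Inv t x) (sym (+-identityʳ s)) inv
    from s (suc L) x inv =
      (λ v → snd v s (x v)) , (λ v inbox → iterate (snd v) (rcv v) (suc s) L (rcv v s (x v) inbox)) ,
      (λ _ → refl) , bounded s x inv , λ inbox eq →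
      subst (λ t → Achieves L (λ v → iterate (snd v) (rcv v) (suc s) L (rcv v s (x v) (inbox v))) (Inv t))
        (sym (+-suc s L)) (from (suc s) L _ (step s x inv inbox eq))

-- From specified programs to the actual execution

module PhaseExecution
  (phase : ∀ {d} → ℕ → NodeInput d → ℕ → Prog d (Maybe Bool))
  (k : ℕ) {n : ℕ} {G : Graph n} (P : Ports G)
  (input : ∀ v → NodeInput (Ports.degree P v)) (B : ℕ) where

  open Ports P
  open Algorithm (repeatPhases phase)
  open Execution (repeatPhases phase) k P input
  open Network P (2 ^ B)

  Running : ℕ → ℕ → (∀ v → Prog (degree v) (Maybe Bool)) → Set
  Running t g ps = ∀ v → state t v ≡ node (phase k (input v)) g (ps v)

  BoundedBefore : ℕ → Set
  BoundedBefore t₀ = ∀ t → t < t₀ → ∀ v p → length (send (state t v) p) ≤ B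

  boundedBefore-suc : ∀ {t} → BoundedBefore t →
    (∀ v p → length (send (state t v) p) ≤ B) → BoundedBefore (suc t)
  boundedBefore-suc before now t t<1+t₀ with m<1+n⇒m<n∨m≡n t<1+t₀
  ... | inj₁ t<t₀ = before t t<t₀
  ... | inj₂ refl = now

  -- Decoding undoes encoding, so the inboxes that really arrive satisfy the constraint under which
  -- `Achieves` promises its continuation.
  run : ∀ t₀ g L ps {Q : (Fin n → Maybe Bool) → Set} →
        BoundedBefore t₀ → Running t₀ g ps → Achieves L ps Q →
        BoundedBefore (t₀ + L) ×
        Σ (Fin n → Maybe Bool) λ x → Q x × Running (t₀ + L) g (λ v → return (x v))
  run t₀ g zero ps before running (x , e , q) rewrite +-identityʳ t₀ =
    before , x , q , λ v → trans (running v) (cong (node (phase k (input v)) g) (e v))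
  run t₀ g (suc L) ps before running (s , f , e , b , κ) rewrite +-suc t₀ L =
    run (suc t₀) g L (λ v → f v (inbox v)) (boundedBefore-suc before now)
      (λ v → cong (λ σ → receive σ (received v)) (at v))
      (κ inbox λ v p → trans
        (cong (λ σ → decode (send σ (reverse v p))) (at (neighbour v p)))
        (decode-encode _))
    where
    at : ∀ v → state t₀ v ≡ node (phase k (input v)) g (round (s v) (f v))
    at v = trans (running v) (cong (node (phase k (input v)) g) (e v))
    received : ∀ v → Fin (degree v) → Message
    received v p = send (state t₀ (neighbour v p)) (reverse v p)
    inbox = λ v → decode ∘ received v
    now : ∀ v p → length (send (state t₀ v) p) ≤ B
    now v p rewrite at v = length-encode {s v p} (b v p)

  retry : ∀ {t g} {x : Fin n → Maybe Bool} → (∀ v → x v ≡ nothing) → BoundedBefore t →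
          Running t g (λ v → return (x v)) →
          BoundedBefore (suc t) × Running (suc t) (2 * g) (λ v → phase k (input v) (2 * g))
  retry {t} {g} {x} fail before running = boundedBefore-suc before now ,
    λ v → cong (λ σ → receive σ λ p → send (state t (neighbour v p)) (reverse v p)) (at v)
    where
    at : ∀ v → state t v ≡ node (phase k (input v)) g (return nothing)
    at v = trans (running v) (cong (λ a → node (phase k (input v)) g (return a)) (fail v))
    now : ∀ v p → length (send (state t v) p) ≤ B
    now v p rewrite at v = z≤n

  -- All nodes are silent once they have answered, so the bound on the finitely many earlier rounds
  -- extends to all time.
  finish : ∀ {t g} {x : Fin n → Maybe Bool} (b : Fin n → Bool) → (∀ v → x v ≡ just (b v)) → BoundedBefore t →
           Running t g (λ v → return (x v)) →
           MessagesBounded B × (∀ v → output (state t v) ≡ just (b v))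
  finish {t} {g} {x} b succeed before running = bounded , done t ≤-refl
    where
    done : ∀ t′ → t ≤ t′ → ∀ v → output (state t′ v) ≡ just (b v)
    done t′ t≤t′ v with m≤n⇒m<n∨m≡n t≤t′
    done (suc t′) _ v | inj₁ (s≤s t≤t′) =
      final (state t′ v) (done t′ t≤t′ v) λ p → send (state t′ (neighbour v p)) (reverse v p)
    done t′ _ v | inj₂ refl = trans (cong output (running v)) (succeed v)

    bounded : MessagesBounded B
    bounded t′ v p with t′ <? t
    ... | yes t′<t = before t′ t′<t v p
    ... | no t′≮t rewrite silent (state t′ v) (done t′ (≮⇒≥ t′≮t) v) p = z≤n

-- Walks and ports

module _ {n : ℕ} {G : Graph n} where

  infixr 5 _++ʷ_

  _++ʷ_ : ∀ {u v w ℓ m} → Walk G u v ℓ → Walk G v w m → Walk G u w (ℓ + m)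
  []       ++ʷ w′ = w′
  (e ∷ w) ++ʷ w′ = e ∷ (w ++ʷ w′)

  reverseWalk : ∀ {u v ℓ} → Walk G u v ℓ → Walk G v u ℓ
  reverseWalk [] = []
  reverseWalk {ℓ = suc ℓ} (e ∷ w) =
    subst (Walk G _ _) (+-comm ℓ 1) (reverseWalk w ++ʷ Adj-sym G e ∷ [])

module PortLemmas {n : ℕ} {G : Graph n} (P : Ports G) where
  open Ports P

  adjacent : ∀ v p → Adj G v (neighbour v p)
  adjacent v p = proj₂ (Inverse.to (port v) p)

  portTo : ∀ {v u} → Adj G v u → ∃[ p ] neighbour v p ≡ u
  portTo {v} {u} e = Inverse.from (port v) (u , e) ,
    cong proj₁ (Inverse.strictlyInverseˡ (port v) (u , e))

  neighbour-reverse : ∀ v p → neighbour (neighbour v p) (reverse v p) ≡ v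
  neighbour-reverse v p = proj₂ (portTo (Adj-sym G (adjacent v p)))

  neighbour-injective : ∀ v {p q} → neighbour v p ≡ neighbour v q → p ≡ q
  neighbour-injective v {p} {q} eq = begin
    p                             ≡⟨ Inverse.strictlyInverseʳ (port v) p ⟨
    Inverse.from (port v) (Inverse.to (port v) p)
      ≡⟨ cong (Inverse.from (port v)) (to≡ (Inverse.to (port v) p) (Inverse.to (port v) q) eq) ⟩
    Inverse.from (port v) (Inverse.to (port v) q)
      ≡⟨ Inverse.strictlyInverseʳ (port v) q ⟩
    q                             ∎
    where
    open ≡-Reasoning
    to≡ : ∀ (x y : ∃ (Adj G v)) → proj₁ x ≡ proj₁ y → x ≡ y
    to≡ (u , e) (.u , e′) refl = cong (u ,_) (T-irrelevant e e′)

-- Flooding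

flood : ∀ {d} → (ℕ → ℕ → ℕ) → ℕ → ℕ → Prog d ℕ
flood pick = iterate (λ _ x _ → x) (λ _ x inbox → Vector.foldr pick x inbox) 0

-- Common ground of minimum (with `_≤_`) and maximum (with `_≥_`): one flooding lemma then serves
-- the election, the agreement test and the final broadcast.
record IsSelection (_≼_ : ℕ → ℕ → Set) (pick : ℕ → ℕ → ℕ) : Set where
  field
    sel    : ∀ a b → pick a b ≡ a ⊎ pick a b ≡ b
    ≼-refl  : ∀ {a} → a ≼ a
    ≼-trans : ∀ {a b c} → a ≼ b → b ≼ c → a ≼ c
    lowerˡ : ∀ a b → pick a b ≼ a
    lowerʳ : ∀ a b → pick a b ≼ b

  foldr-lower-init : ∀ {d} x (inbox : Fin d → ℕ) → Vector.foldr pick x inbox ≼ x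
  foldr-lower-init {zero}  x inbox = ≼-refl
  foldr-lower-init {suc d} x inbox =
    ≼-trans (lowerʳ _ _) (foldr-lower-init x (inbox ∘ suc))

  foldr-lower : ∀ {d} x (inbox : Fin d → ℕ) p → Vector.foldr pick x inbox ≼ inbox p
  foldr-lower x inbox zero    = lowerˡ _ _
  foldr-lower x inbox (suc p) = ≼-trans (lowerʳ _ _) (foldr-lower x (inbox ∘ suc) p)

  foldr-sel : ∀ {d} x (inbox : Fin d → ℕ) →
    Vector.foldr pick x inbox ≡ x ⊎ ∃[ p ] Vector.foldr pick x inbox ≡ inbox p
  foldr-sel {zero}  x inbox = inj₁ refl
  foldr-sel {suc d} x inbox
    with sel (inbox zero) (Vector.foldr pick x (inbox ∘ suc)) | foldr-sel x (inbox ∘ suc)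
  ... | inj₁ eq | _              = inj₂ (zero , eq)
  ... | inj₂ eq | inj₁ eq′       = inj₁ (trans eq eq′)
  ... | inj₂ eq | inj₂ (p , eq′) = inj₂ (suc p , trans eq eq′)

⊓-isSelection : IsSelection _≤_ _⊓_
⊓-isSelection = record
  { sel = ⊓-sel ; ≼-refl = ≤-refl ; ≼-trans = ≤-trans ; lowerˡ = m⊓n≤m ; lowerʳ = m⊓n≤n }

⊔-isSelection : IsSelection _≥_ _⊔_
⊔-isSelection = record
  { sel = ⊔-sel ; ≼-refl = ≤-refl ; ≼-trans = λ p q → ≤-trans q p
  ; lowerˡ = m≤m⊔n ; lowerʳ = m≤n⊔m }

-- Breadth-first search: after s rounds, a recorded distance of s + 1 means not reached yet.

firstMessage : ∀ {d} (inbox : Fin d → ℕ) → Dec (∃[ p ] inbox p ≢ 0)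
firstMessage inbox = Fin.any? (λ p → ¬? (inbox p ≟ 0))

bfsSend : ∀ {d} → (Fin d → Bool) → ℕ → ℕ × Maybe (Fin d) → Fin d → ℕ
bfsSend out s (r , _) p with r ≤? s
... | yes _ = if out p then 1 else 0
... | no  _ = 0

-- An unreached node carries `s + 1`, which is its distance if a message arrives in this round;
-- otherwise the tentative value moves on with the clock. The port of the first message becomes the
-- parent.
bfsReceive : ∀ {d} → ℕ → ℕ × Maybe (Fin d) → (Fin d → ℕ) → ℕ × Maybe (Fin d)
bfsReceive s (r , q) inbox with r ≤? s | firstMessage inbox
... | yes _ | _           = r , q
... | no  _ | yes (p , _) = r , just p
... | no  _ | no  _       = suc r , q

bfs : ∀ {d} → Bool → (Fin d → Bool) → ℕ → Prog d (ℕ × Maybe (Fin d))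
bfs source out L = iterate (bfsSend out) bfsReceive 0 L ((if source then 0 else 1) , nothing)

bfsReceive-reached : ∀ {d} s (x : ℕ × Maybe (Fin d)) inbox → proj₁ x ≤ s → bfsReceive s x inbox ≡ x
bfsReceive-reached s (r , q) inbox r≤s with r ≤? s
... | yes _   = refl
... | no r≰s = contradiction r≤s r≰s

bfsSend-reached : ∀ {d} (out : Fin d → Bool) s x p →
                  bfsSend out s x p ≢ 0 → proj₁ x ≤ s × out p ≡ true
bfsSend-reached out s (r , _) p ≢0 with r ≤? s
... | no _ = contradiction refl ≢0
... | yes r≤s with out p
...   | true  = r≤s , refl
...   | false = contradiction refl ≢0

bfsSend-out : ∀ {d} (out : Fin d → Bool) s x p →
              proj₁ x ≤ s → out p ≡ true → bfsSend out s x p ≢ 0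
bfsSend-out out s (r , _) p r≤s o with r ≤? s
... | no r≰s = contradiction r≤s r≰s
... | yes _ rewrite o = λ ()

bfsSend≤1 : ∀ {d} (out : Fin d → Bool) s x p → bfsSend out s x p ≤ 1
bfsSend≤1 out s (r , _) p with r ≤? s
... | no _ = z≤n
... | yes _ with out p
...   | true  = ≤-refl
...   | false = z≤n

module Primitives {n : ℕ} {G : Graph n} (P : Ports G) (bound : ℕ) where
  open Ports P
  open PortLemmas P
  open Network P bound

  -- The `≼`-least value of `x` on the ball of radius `L` around each node, expressed through walks
  -- alone.
  Flooded : (ℕ → ℕ → Set) → ℕ → (Fin n → ℕ) → (Fin n → ℕ) → Set
  Flooded _≼_ L x y =
    (∀ v → ∃[ u ] ∃[ ℓ ] ℓ ≤ L × Walk G v u ℓ × y v ≡ x u) ×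
    (∀ {v u ℓ} → Walk G v u ℓ → ℓ ≤ L → y v ≼ x u)

  achieves-flood : ∀ {_≼_ pick} → IsSelection _≼_ pick → ∀ L x →
    (∀ v → Fin (degree v) → ∀ u → x u < bound) →
    Achieves L (λ v → flood pick L (x v)) (Flooded _≼_ L x)
  achieves-flood {_≼_} {pick} isSel L x x<bound =
    achieves-iterate (λ s → Flooded _≼_ s x) bounded step L x
      ((λ v → v , 0 , z≤n , [] , refl) , λ { [] z≤n → ≼-refl })
    where
    open IsSelection isSel
    bounded : ∀ s y → Flooded _≼_ s x y → ∀ v → Fin (degree v) → y v < bound
    bounded s y (attained , _) v p with attained v
    ... | u , _ , _ , _ , eq = subst (_< bound) (sym eq) (x<bound v p u)

    step : ∀ s y → Flooded _≼_ s x y → (inbox : ∀ v → Fin (degree v) → ℕ) →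
           (∀ v p → inbox v p ≡ y (neighbour v p)) →
           Flooded _≼_ (suc s) x (λ v → Vector.foldr pick (y v) (inbox v))
    step s y (attained , lower) inbox eq = attained′ , lower′
      where
      attained′ : ∀ v → ∃[ u ] ∃[ ℓ ] ℓ ≤ suc s × Walk G v u ℓ ×
                  Vector.foldr pick (y v) (inbox v) ≡ x u
      attained′ v with foldr-sel (y v) (inbox v)
      ... | inj₁ e with attained v
      ...   | u , ℓ , ℓ≤s , w , e′ = u , ℓ , m≤n⇒m≤1+n ℓ≤s , w , trans e e′
      attained′ v | inj₂ (p , e) with attained (neighbour v p)
      ...   | u , ℓ , ℓ≤s , w , e′ =
        u , suc ℓ , s≤s ℓ≤s , adjacent v p ∷ w , trans e (trans (eq v p) e′)

      lower′ : ∀ {v u ℓ} → Walk G v u ℓ → ℓ ≤ suc s → Vector.foldr pick (y v) (inbox v) ≼ x u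
      lower′ {v} [] _ = ≼-trans (foldr-lower-init (y v) (inbox v)) (lower [] z≤n)
      lower′ {v} (e ∷ w) (s≤s ℓ≤s) with portTo e
      ... | p , refl =
        ≼-trans (subst (Vector.foldr pick (y v) (inbox v) ≼_) (eq v p) (foldr-lower _ _ p))
                (lower w ℓ≤s)

  -- Directed distances from the sources, truncated at `L`, in the form of local conditions, so that
  -- no directed walks have to be built. A rank above `L` only says that the node is not reached
  -- within `L` steps. Edges point towards `v`, hence `out` is asked at the reverse port.
  record Ranked (source : Fin n → Bool) (out : ∀ v → Fin (degree v) → Bool) (L : ℕ)
                (x : ∀ v → ℕ × Maybe (Fin (degree v))) : Set where
    rank : Fin n → ℕ
    rank v = proj₁ (x v)
    field
      source⇒0 : ∀ v → source v ≡ true → rank v ≡ 0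
      0⇒source : ∀ v → rank v ≡ 0 → source v ≡ true
      rank-suc : ∀ v p → out (neighbour v p) (reverse v p) ≡ true →
                 rank (neighbour v p) < L → rank v ≤ suc (rank (neighbour v p))
      rank-pred : ∀ v {m} → rank v ≤ L → rank v ≡ suc m →
                  ∃[ p ] proj₂ (x v) ≡ just p × rank (neighbour v p) ≡ m ×
                         out (neighbour v p) (reverse v p) ≡ true

  achieves-bfs : (∀ v → Fin (degree v) → 1 < bound) → ∀ source out L →
    Achieves L (λ v → bfs (source v) (out v) L) (Ranked source out L)
  achieves-bfs 1<bound source out L =
    achieves-weaken L (λ _ → proj₁)
      (achieves-iterate Inv (λ s x _ v p → ≤-<-trans (bfsSend≤1 (out v) s (x v) p) (1<bound v p))
        step L x₀ (ranked₀ , r₀≤1))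
    where
    x₀ : ∀ v → ℕ × Maybe (Fin (degree v))
    x₀ v = (if source v then 0 else 1) , nothing

    -- The upper bound pins every unreached rank to exactly `s + 1`, which `new` extracts.
    Inv : ℕ → (∀ v → ℕ × Maybe (Fin (degree v))) → Set
    Inv s x = Ranked source out s x × (∀ v → proj₁ (x v) ≤ suc s)

    r₀≤1 : ∀ v → proj₁ (x₀ v) ≤ 1
    r₀≤1 v with source v
    ... | true  = z≤n
    ... | false = ≤-refl

    ranked₀ : Ranked source out 0 x₀
    ranked₀ = record
      { source⇒0  = λ v eq → cong (if_then 0 else 1) eq
      ; 0⇒source  = isSource
      ; rank-suc  = λ _ _ _ ()
      ; rank-pred = λ v r≤0 r≡suc → contradiction (trans (sym r≡suc) (n≤0⇒n≡0 r≤0)) λ ()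
      }
      where
      isSource : ∀ v → proj₁ (x₀ v) ≡ 0 → source v ≡ true
      isSource v eq with source v
      ... | true = refl

    step : ∀ s x → Inv s x → (inbox : ∀ v → Fin (degree v) → ℕ) →
           (∀ v p → inbox v p ≡ bfsSend (out (neighbour v p)) s (x (neighbour v p)) (reverse v p)) →
           Inv (suc s) (λ v → bfsReceive s (x v) (inbox v))
    step s x (ranked , r≤1+s) inbox eq = record
      { source⇒0  = λ v src → trans (cong proj₁ (old v (≤-trans (≤-reflexive (source⇒0 v src)) z≤n))) (source⇒0 v src)
      ; 0⇒source  = λ v r′≡0 → 0⇒source v (n≤0⇒n≡0 (≤-trans (grows v) (≤-reflexive r′≡0)))
      ; rank-suc  = suc′
      ; rank-pred = λ v → pred′ v
      } , bounded′
      where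
      open Ranked ranked
      x′ : ∀ v → ℕ × Maybe (Fin (degree v))
      x′ v = bfsReceive s (x v) (inbox v)

      old : ∀ v → rank v ≤ s → x′ v ≡ x v
      old v = bfsReceive-reached s (x v) (inbox v)

      grows : ∀ v → rank v ≤ proj₁ (x′ v)
      grows v with rank v ≤? s | firstMessage (inbox v)
      ... | yes _ | _     = ≤-refl
      ... | no  _ | yes _ = ≤-refl
      ... | no  _ | no  _ = n≤1+n _

      bounded′ : ∀ v → proj₁ (x′ v) ≤ suc (suc s)
      bounded′ v with rank v ≤? s | firstMessage (inbox v)
      ... | yes _ | _     = m≤n⇒m≤1+n (r≤1+s v)
      ... | no  _ | yes _ = m≤n⇒m≤1+n (r≤1+s v)
      ... | no  _ | no  _ = s≤s (r≤1+s v)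

      new : ∀ v → ¬ rank v ≤ s → rank v ≡ suc s
      new v r≰s = ≤-antisym (r≤1+s v) (≰⇒> r≰s)

      suc′ : ∀ v p → out (neighbour v p) (reverse v p) ≡ true →
             proj₁ (x′ (neighbour v p)) < suc s → proj₁ (x′ v) ≤ suc (proj₁ (x′ (neighbour v p)))
      suc′ v p o (s≤s r′u≤s) =
        subst (λ r → proj₁ (x′ v) ≤ suc r) (sym (cong proj₁ (old u ru≤s)))
          (reach (m≤n⇒m<n∨m≡n ru≤s))
        where
        u = neighbour v p
        ru≤s : rank u ≤ s
        ru≤s = ≤-trans (grows u) r′u≤s
        reach : rank u < s ⊎ rank u ≡ s → proj₁ (x′ v) ≤ suc (rank u)
        reach (inj₁ ru<s) =
          subst (_≤ suc (rank u)) (sym (cong proj₁ (old v (≤-trans (rank-suc v p o ru<s) ru<s))))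
            (rank-suc v p o ru<s)
        reach (inj₂ ru≡s) with rank v ≤? s | firstMessage (inbox v)
        ... | yes rv≤s | _     = ≤-trans rv≤s (≤-trans (≤-reflexive (sym ru≡s)) (n≤1+n _))
        ... | no  rv≰s | yes _ = ≤-reflexive (trans (new v rv≰s) (cong suc (sym ru≡s)))
        ... | no  _    | no none = contradiction
          (p , λ e → bfsSend-out (out u) s (x u) (reverse v p) ru≤s o (trans (sym (eq v p)) e)) none

      pred′ : ∀ v {m} → proj₁ (x′ v) ≤ suc s → proj₁ (x′ v) ≡ suc m →
              ∃[ p ] proj₂ (x′ v) ≡ just p × proj₁ (x′ (neighbour v p)) ≡ m ×
                     out (neighbour v p) (reverse v p) ≡ true
      pred′ v {m} r′≤1+s r′≡1+m with rank v ≤? s | firstMessage (inbox v)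
      ... | yes rv≤s | _ with rank-pred v rv≤s r′≡1+m
      ...   | p , parent , ru≡m , o = p , parent ,
        trans (cong proj₁ (old (neighbour v p) (≤-trans (≤-reflexive ru≡m)
          (≤-trans (n≤1+n m) (≤-trans (≤-reflexive (sym r′≡1+m)) rv≤s))))) ru≡m , o
      pred′ v {m} r′≤1+s r′≡1+m | no rv≰s | yes (p , msg)
        with bfsSend-reached _ s (x (neighbour v p)) _ (subst (_≢ 0) (eq v p) msg)
      ...   | ru≤s , o = p , refl , trans (cong proj₁ (old (neighbour v p) ru≤s)) (trans ru≡s s≡m) , o
        where
        s≡m : s ≡ m
        s≡m = suc-injective (trans (sym (new v rv≰s)) r′≡1+m)
        -- A sender reached earlier would have reached `v` by now as well.
        ru≡s : rank (neighbour v p) ≡ s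
        ru≡s with m≤n⇒m<n∨m≡n ru≤s
        ... | inj₂ e    = e
        ... | inj₁ ru<s = contradiction (≤-trans (rank-suc v p o ru<s) ru<s) rv≰s
      pred′ v r′≤1+s r′≡1+m | no rv≰s | no _ =
        contradiction (≤-trans (≤-reflexive (sym (new v rv≰s))) (s≤s⁻¹ r′≤1+s)) (<⇒≱ ≤-refl)

-- Sums over finite sets

when : Bool → ℕ → ℕ
when b x = if b then x else 0

when-≤ : ∀ b x → when b x ≤ x
when-≤ true  x = ≤-refl
when-≤ false x = z≤n

when-0 : ∀ b → when b 0 ≡ 0
when-0 true  = refl
when-0 false = refl

when-+ : ∀ b x y → when b (x + y) ≡ when b x + when b y
when-+ true  x y = refl
when-+ false x y = refl

when-swap : ∀ b c x → when b (when c x) ≡ when c (when b x)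
when-swap true  c     x = refl
when-swap false true  x = refl
when-swap false false x = refl

sum-mono : ∀ {n} {f g : Fin n → ℕ} → (∀ i → f i ≤ g i) → sum f ≤ sum g
sum-mono {zero}  f≤g = z≤n
sum-mono {suc n} f≤g = +-mono-≤ (f≤g zero) (sum-mono (f≤g ∘ suc))

sum-0 : ∀ {n} {f : Fin n → ℕ} → (∀ i → f i ≡ 0) → sum f ≡ 0
sum-0 {n} f≡0 = trans (sum-cong-≗ f≡0) (sum-replicate-zero n)

term≤sum : ∀ {n} (f : Fin n → ℕ) i → f i ≤ sum f
term≤sum f zero    = m≤m+n _ _
term≤sum f (suc i) = ≤-trans (term≤sum (f ∘ suc) i) (m≤n+m _ _)

sum-≤1 : ∀ {n} {f : Fin n → ℕ} → (∀ i → f i ≤ 1) → sum f ≤ n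
sum-≤1 {zero}  f≤1 = z≤n
sum-≤1 {suc n} f≤1 = +-mono-≤ (f≤1 zero) (sum-≤1 (f≤1 ∘ suc))

sum-≥ : ∀ {n} {f : Fin n → ℕ} {a} → (∀ i → a ≤ f i) → n * a ≤ sum f
sum-≥ {zero}  a≤f = z≤n
sum-≥ {suc n} a≤f = +-mono-≤ (a≤f zero) (sum-≥ (a≤f ∘ suc))

sum-only : ∀ {n} (i : Fin n) (f : Fin n → ℕ) → sum (λ j → when (does (i Fin.≟ j)) (f j)) ≡ f i
sum-only {suc n} zero    f = trans (cong₂ _+_ refl (sum-0 {n} λ _ → refl)) (+-identityʳ _)
sum-only {suc n} (suc i) f = sum-only i (f ∘ suc)

when-sum : ∀ {n} b (f : Fin n → ℕ) → when b (sum f) ≡ sum (λ i → when b (f i))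
when-sum true  f = refl
when-sum {n} false f = sym (sum-0 {n} λ _ → refl)

does-cong : ∀ {a b} {A : Set a} {B : Set b} (A? : Dec A) (B? : Dec B) → (A → B) → (B → A) →
            does A? ≡ does B?
does-cong (yes a) B? f g = sym (dec-true B? (f a))
does-cong (no ¬a) B? f g = sym (dec-false B? (¬a ∘ g))

-- Turns a sum over ports into a sum over nodes. Both sides are evaluations of one double sum over
-- the pairs `e p ≡ u`, where each `u` has at most one `p`.
sum-injective : ∀ {m n} (e : Fin m → Fin n) → (∀ {p q} → e p ≡ e q → p ≡ q) → ∀ g →
                (∀ u → (∀ p → e p ≢ u) → g u ≡ 0) → sum (g ∘ e) ≡ sum g
sum-injective {m} {n} e inj g off = begin
  sum (λ p → g (e p))                                  ≡⟨ sum-cong-≗ (λ p → sym (sum-only (e p) g)) ⟩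
  sum (λ p → sum λ u → when (does (e p Fin.≟ u)) (g u)) ≡⟨ ∑-comm (λ p u → when (does (e p Fin.≟ u)) (g u)) ⟩
  sum (λ u → sum λ p → when (does (e p Fin.≟ u)) (g u)) ≡⟨ sum-cong-≗ fibre ⟩
  sum g                                                ∎
  where
  open ≡-Reasoning
  fibre : ∀ u → sum (λ p → when (does (e p Fin.≟ u)) (g u)) ≡ g u
  fibre u with Fin.any? (λ p → e p Fin.≟ u)
  ... | yes (q , refl) = trans
    (sum-cong-≗ λ p → cong (λ b → when b (g u))
      (does-cong (e p Fin.≟ u) (q Fin.≟ p) (sym ∘ inj) (sym ∘ cong e)))
    (sum-only q (λ _ → g u))
  ... | no none = trans
    (sum-0 λ p → cong (λ b → when b (g u)) (dec-false (e p Fin.≟ u) (λ eq → none (p , eq))))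
    (sym (off u λ p eq → none (p , eq)))

-- Pipelined convergecast: a node of depth d handles the i-th sum in round i + T - d, so
-- that the i-th sum reaches the root in round i + T.

share : ℕ → (ℕ → ℕ) → ℕ → ℕ
share T own x = when (does (T ≤? x)) (own (x ∸ T))

subtotal : ℕ → ℕ → (ℕ → ℕ) → ℕ → ℕ → ℕ
subtotal T depth own s acc = share T own (s + depth) + acc

toParent : ∀ {d} → ℕ → Maybe (Fin d) → ℕ → Fin d → ℕ
toParent zero    _        x p = 0
toParent (suc _) nothing  x p = 0
toParent (suc _) (just q) x p = when (does (q Fin.≟ p)) x

-- The first component is what the children sent in the last round. The second logs the node's own
-- subtotal round by round; only at the root are these full sums.
convergecast : ∀ {d} → ℕ → ℕ → Maybe (Fin d) → (ℕ → ℕ) → ℕ → Prog d (ℕ × (ℕ → ℕ))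
convergecast T depth parent own L = iterate
  (λ s x → toParent depth parent (subtotal T depth own s (proj₁ x)))
  (λ s x inbox → sum inbox ,
     λ j → if does (j ≟ s) then subtotal T depth own s (proj₁ x) else proj₂ x j)
  0 L (0 , λ _ → 0)

toParent-≤ : ∀ {d} depth parent x (p : Fin d) → toParent depth parent x p ≤ x
toParent-≤ zero    _        x p = z≤n
toParent-≤ (suc _) nothing  x p = z≤n
toParent-≤ (suc _) (just q) x p = when-≤ (does (q Fin.≟ p)) x

module Convergecast {n : ℕ} {G : Graph n} (P : Ports G) (bound : ℕ)
  (depth : Fin n → ℕ) (parent : ∀ v → Maybe (Fin (Ports.degree P v)))
  (T : ℕ) (depth≤T : ∀ v → depth v ≤ T)
  (root : Fin n) (root-depth : depth root ≡ 0) (root-unique : ∀ v → depth v ≡ 0 → v ≡ root)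
  (parent-depth : ∀ v {m} → depth v ≡ suc m →
                  ∃[ p ] parent v ≡ just p × depth (Ports.neighbour P v p) ≡ m)
  (own : Fin n → ℕ → ℕ) (own≤1 : ∀ v i → own v i ≤ 1)
  (n<bound : ∀ v → Fin (Ports.degree P v) → n < bound) where

  open Ports P
  open PortLemmas P
  open Network P bound
  open ≡-Reasoning

  shareOf : Fin n → ℕ → ℕ
  shareOf v = share T (own v)

  shareOf≤1 : ∀ v x → shareOf v x ≤ 1
  shareOf≤1 v x = ≤-trans (when-≤ (does (T ≤? x)) _) (own≤1 v _)

  atDepth : ℕ → Fin n → Bool
  atDepth d v = does (depth v ≟ d)

  isParent : Fin n → Fin n → Bool
  isParent u v = at (depth u) (parent u)
    where
    at : ℕ → Maybe (Fin (degree u)) → Bool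
    at zero    _        = false
    at (suc _) nothing  = false
    at (suc _) (just q) = does (neighbour u q Fin.≟ v)

  received : ∀ v p x → toParent (depth (neighbour v p)) (parent (neighbour v p)) x (reverse v p)
             ≡ when (isParent (neighbour v p) v) x
  received v p x with depth (neighbour v p) | parent (neighbour v p)
  ... | zero  | _       = refl
  ... | suc _ | nothing = refl
  ... | suc _ | just q  = cong (λ b → when b x)
    (does-cong (q Fin.≟ reverse v p) (neighbour u q Fin.≟ v)
      (λ { refl → neighbour-reverse v p })
      (λ eq → neighbour-injective u (trans eq (sym (neighbour-reverse v p)))))
    where u = neighbour v p

  isParent-adjacent : ∀ u v x → (∀ p → neighbour v p ≢ u) → when (isParent u v) x ≡ 0
  isParent-adjacent u v x far with depth u | parent u
  ... | zero  | _       = refl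
  ... | suc _ | nothing = refl
  ... | suc _ | just q  = cong (λ b → when b x) (dec-false (neighbour u q Fin.≟ v)
    λ { refl → far (reverse u q) (neighbour-reverse u q) })

  -- A node at depth d + 1 has one parent, at depth d, and the root has none. So a subtotal sent
  -- upwards is counted exactly once, on the next level.
  parents-at-depth : ∀ d u x →
    sum (λ v → when (atDepth d v) (when (isParent u v) x)) ≡ when (atDepth (suc d) u) x
  parents-at-depth d u x with depth u | parent u | (λ {m} → parent-depth u {m})
  ... | zero  | _ | _ = sum-0 λ v → when-swap (atDepth d v) false x
  ... | suc m | q | above with above refl
  ...   | p , refl , eq = trans
    (sum-cong-≗ λ v → when-swap (atDepth d v) (does (neighbour u p Fin.≟ v)) x)
    (trans (sum-only (neighbour u p) (λ v → when (atDepth d v) x))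
      (cong (λ b → when b x) (does-cong (depth (neighbour u p) ≟ d) (suc m ≟ suc d)
        (λ e → cong suc (trans (sym eq) e)) (λ e → trans eq (suc-injective e)))))

  split-depth : ∀ d v x →
    when (atDepth d v) x + when (does (suc d ≤? depth v)) x ≡ when (does (d ≤? depth v)) x
  split-depth d v x with <-cmp (depth v) d
  ... | tri< lt neq _
    rewrite dec-false (depth v ≟ d) neq | dec-false (suc d ≤? depth v) (<⇒≱ (m<n⇒m<1+n lt))
          | dec-false (d ≤? depth v) (<⇒≱ lt) = refl
  ... | tri≈ _ eq _
    rewrite dec-true (depth v ≟ d) eq | dec-false (suc d ≤? depth v) (<⇒≱ (s≤s (≤-reflexive eq)))
          | dec-true (d ≤? depth v) (≤-reflexive (sym eq)) = +-identityʳ x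
  ... | tri> _ neq gt
    rewrite dec-false (depth v ≟ d) neq | dec-true (suc d ≤? depth v) gt
          | dec-true (d ≤? depth v) (<⇒≤ gt) = refl

  State : Set
  State = ∀ (v : Fin n) → ℕ × (ℕ → ℕ)

  val : ℕ → State → Fin n → ℕ
  val s x v = subtotal T (depth v) (own v) s (proj₁ (x v))

  -- The pipeline invariant: in round s, level d carries the sum of index s + d - T, restricted to
  -- the nodes of depth at least d. Summing over whole levels avoids any mention of subtrees, and
  -- one round moves what level d + 1 held to level d, where the own shares of that level join it.
  LevelSums : ℕ → State → Set
  LevelSums s x = ∀ d → sum (λ v → when (atDepth d v) (val s x v)) ≡
                        sum (λ v → when (does (d ≤? depth v)) (shareOf v (s + d)))

  Totals : ℕ → State → Set
  Totals s x = ∀ j → j < s → proj₂ (x root) j ≡ sum (λ v → shareOf v j)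

  at-own-depth : ∀ d s v → when (atDepth d v) (shareOf v (s + depth v)) ≡ when (atDepth d v) (shareOf v (s + d))
  at-own-depth d s v with depth v ≟ d
  ... | yes eq = cong (λ e → when (atDepth d v) (shareOf v (s + e))) eq
  ... | no neq rewrite dec-false (depth v ≟ d) neq = refl

  levelSums₀ : LevelSums 0 (λ _ → 0 , λ _ → 0)
  levelSums₀ d = sum-cong-≗ λ v → begin
    when (atDepth d v) (shareOf v (depth v) + 0)  ≡⟨ cong (when (atDepth d v)) (+-identityʳ _) ⟩
    when (atDepth d v) (shareOf v (depth v))      ≡⟨ at-own-depth d 0 v ⟩
    when (atDepth d v) (shareOf v d)              ≡⟨ +-identityʳ _ ⟨
    when (atDepth d v) (shareOf v d) + 0          ≡⟨ cong₂ _+_ refl (deeper d v) ⟨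
    when (atDepth d v) (shareOf v d) + when (does (suc d ≤? depth v)) (shareOf v d)
                                                  ≡⟨ split-depth d v (shareOf v d) ⟩
    when (does (d ≤? depth v)) (shareOf v d)      ∎
    where
    -- A level with nodes below it has d < T, and `share` is still 0 there.
    deeper : ∀ d v → when (does (suc d ≤? depth v)) (shareOf v d) ≡ 0
    deeper d v with suc d ≤? depth v
    ... | no d≮depth rewrite dec-false (suc d ≤? depth v) d≮depth = refl
    ... | yes d<depth = trans (cong (when (does (suc d ≤? depth v))) 
      (cong (λ b → when b (own v (d ∸ T))) (dec-false (T ≤? d) (<⇒≱ (<-≤-trans d<depth (depth≤T v))))))
      (when-0 (does (suc d ≤? depth v)))

  -- One subtotal is at most the sum over its level, which collects at most 1 from each node. This
  -- keeps the messages logarithmic.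
  val≤n : ∀ s x → LevelSums s x → ∀ v → val s x v ≤ n
  val≤n s x level v = R.begin
    val s x v
      R.≡⟨ cong (λ b → when b (val s x v)) (dec-true (depth v ≟ depth v) refl) ⟨
    when (atDepth (depth v) v) (val s x v)
      R.≤⟨ term≤sum (λ u → when (atDepth (depth v) u) (val s x u)) v ⟩
    sum (λ u → when (atDepth (depth v) u) (val s x u))
      R.≡⟨ level (depth v) ⟩
    sum (λ u → when (does (depth v ≤? depth u)) (shareOf u (s + depth v)))
      R.≤⟨ sum-≤1 (λ u → ≤-trans (when-≤ (does (depth v ≤? depth u)) _) (shareOf≤1 u (s + depth v))) ⟩
    n                                                           R.∎
    where module R = ≤-Reasoning

  val-root : ∀ s x → LevelSums s x → val s x root ≡ sum (λ v → shareOf v s)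
  val-root s x level = begin
    val s x root                                     ≡⟨ sum-only root (val s x) ⟨
    sum (λ v → when (does (root Fin.≟ v)) (val s x v)) ≡⟨ sum-cong-≗ (λ v → cong (λ b → when b (val s x v))
                                                        (does-cong (root Fin.≟ v) (depth v ≟ 0)
                                                          (λ { refl → root-depth }) (sym ∘ root-unique v))) ⟩
    sum (λ v → when (atDepth 0 v) (val s x v))       ≡⟨ level 0 ⟩
    sum (λ v → shareOf v (s + 0))                    ≡⟨ cong (λ j → sum λ v → shareOf v j) (+-identityʳ s) ⟩
    sum (λ v → shareOf v s)                          ∎

  achieves-convergecast : ∀ L →
    Achieves L (λ v → convergecast T (depth v) (parent v) (own v) L) (Totals L)
  achieves-convergecast L = achieves-weaken L (λ _ → proj₂)
    (achieves-iterate (λ s x → LevelSums s x × Totals s x)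
      (λ s x inv v p → ≤-<-trans
        (≤-trans (toParent-≤ (depth v) (parent v) _ p) (val≤n s x (proj₁ inv) v)) (n<bound v p))
      step L _ (levelSums₀ , λ _ ()))
    where
    step : ∀ s x → LevelSums s x × Totals s x → (inbox : ∀ v → Fin (degree v) → ℕ) →
      (∀ v p → inbox v p ≡ toParent (depth (neighbour v p)) (parent (neighbour v p))
                                   (val s x (neighbour v p)) (reverse v p)) →
      LevelSums (suc s) (λ v → sum (inbox v) , λ j → if does (j ≟ s) then val s x v else proj₂ (x v) j) ×
      Totals (suc s) (λ v → sum (inbox v) , λ j → if does (j ≟ s) then val s x v else proj₂ (x v) j)
    step s x (level , totals) inbox eq = level′ , totals′
      where
      x′ : State
      x′ v = sum (inbox v) , λ j → if does (j ≟ s) then val s x v else proj₂ (x v) j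

      gathered : ∀ v → sum (inbox v) ≡ sum (λ u → when (isParent u v) (val s x u))
      gathered v = trans
        (sum-cong-≗ λ p → trans (eq v p) (received v p (val s x (neighbour v p))))
        (sum-injective (neighbour v) (neighbour-injective v) (λ u → when (isParent u v) (val s x u))
          (λ u → isParent-adjacent u v (val s x u)))

      fromBelow : ∀ d → sum (λ v → when (atDepth d v) (sum (inbox v))) ≡
                        sum (λ u → when (does (suc d ≤? depth u)) (shareOf u (suc s + d)))
      fromBelow d = begin
        sum (λ v → when (atDepth d v) (sum (inbox v)))
          ≡⟨ sum-cong-≗ (λ v → trans (cong (when (atDepth d v)) (gathered v))
               (when-sum (atDepth d v) (λ u → when (isParent u v) (val s x u)))) ⟩
        sum (λ v → sum λ u → when (atDepth d v) (when (isParent u v) (val s x u)))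
          ≡⟨ ∑-comm (λ v u → when (atDepth d v) (when (isParent u v) (val s x u))) ⟩
        sum (λ u → sum λ v → when (atDepth d v) (when (isParent u v) (val s x u)))
          ≡⟨ sum-cong-≗ (λ u → parents-at-depth d u (val s x u)) ⟩
        sum (λ u → when (atDepth (suc d) u) (val s x u))
          ≡⟨ level (suc d) ⟩
        sum (λ u → when (does (suc d ≤? depth u)) (shareOf u (s + suc d)))
          ≡⟨ cong (λ j → sum λ u → when (does (suc d ≤? depth u)) (shareOf u j)) (+-suc s d) ⟩
        sum (λ u → when (does (suc d ≤? depth u)) (shareOf u (suc s + d))) ∎

      level′ : LevelSums (suc s) x′
      level′ d = begin
        sum (λ v → when (atDepth d v) (shareOf v (suc s + depth v) + sum (inbox v)))
          ≡⟨ sum-cong-≗ (λ v → trans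
               (when-+ (atDepth d v) (shareOf v (suc s + depth v)) (sum (inbox v)))
               (cong (λ m → m + below v) (at-own-depth d (suc s) v))) ⟩
        sum (λ v → here v + below v)   ≡⟨ ∑-distrib-+ here below ⟩
        sum here + sum below           ≡⟨ cong (λ m → sum here + m) (fromBelow d) ⟩
        sum here + sum deeper          ≡⟨ ∑-distrib-+ here deeper ⟨
        sum (λ v → here v + deeper v)  ≡⟨ sum-cong-≗ (λ v → split-depth d v (shareOf v (suc s + d))) ⟩
        sum (λ v → when (does (d ≤? depth v)) (shareOf v (suc s + d))) ∎
        where
        here below deeper : Fin n → ℕ
        here   v = when (atDepth d v) (shareOf v (suc s + d))
        below  v = when (atDepth d v) (sum (inbox v))
        deeper v = when (does (suc d ≤? depth v)) (shareOf v (suc s + d))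

      totals′ : Totals (suc s) x′
      totals′ j j<1+s with j ≟ s
      ... | yes refl rewrite dec-true (j ≟ j) refl = val-root s x level
      ... | no j≢s rewrite dec-false (j ≟ s) j≢s = totals j (≤∧≢⇒< (s≤s⁻¹ j<1+s) j≢s)

-- Arithmetic of layers, ratios and least indices

half-≤ : ∀ r i → r ≤ suc (2 * i) → ⌊ r /2⌋ ≤ i
half-≤ 0             i       _ = z≤n
half-≤ 1             i       _ = z≤n
half-≤ (suc (suc r)) zero    (s≤s ())
half-≤ (suc (suc r)) (suc i) (s≤s r≤) rewrite +-suc i (i + 0) = s≤s (half-≤ r i (s≤s⁻¹ r≤))

half-≤⁻¹ : ∀ r i → ⌊ r /2⌋ ≤ i → r ≤ suc (2 * i)
half-≤⁻¹ 0             i       _ = z≤n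
half-≤⁻¹ 1             i       _ = s≤s z≤n
half-≤⁻¹ (suc (suc r)) (suc i) (s≤s h≤i) rewrite +-suc i (i + 0) = s≤s (s≤s (half-≤⁻¹ r i h≤i))

half-≥ : ∀ r i → 2 * i ≤ r → i ≤ ⌊ r /2⌋
half-≥ r             zero    _ = z≤n
half-≥ 1             (suc i) (s≤s 2i≤r) rewrite +-suc i (i + 0) = contradiction 2i≤r λ ()
half-≥ (suc (suc r)) (suc i) (s≤s 2i≤r) rewrite +-suc i (i + 0) = s≤s (half-≥ r i (s≤s⁻¹ 2i≤r))

ratio-≤ : ∀ a b k .{{_ : NonZero k}} → k * a ≤ suc k * b →
          + a / 1 ℚ.≤ (1ℚ ℚ.+ + 1 / k) ℚ.* (+ b / 1)
ratio-≤ a b k@(suc k-1) ka≤ = ℚ.toℚᵘ-cancel-≤ (begin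
  ℚ.toℚᵘ (+ a / 1)                       ≃⟨ ℚ.toℚᵘ-fromℚᵘ (+ a ℚᵘ./ 1) ⟩
  + a ℚᵘ./ 1                             ≤⟨ ℚᵘ.*≤* cross ⟩
  (ℚᵘ.1ℚᵘ ℚᵘ.+ + 1 ℚᵘ./ k) ℚᵘ.* (+ b ℚᵘ./ 1)
    ≃⟨ ℚᵘ.*-cong (ℚᵘ.+-congʳ ℚᵘ.1ℚᵘ (ℚ.toℚᵘ-fromℚᵘ (+ 1 ℚᵘ./ k))) (ℚ.toℚᵘ-fromℚᵘ (+ b ℚᵘ./ 1)) ⟨
  (ℚᵘ.1ℚᵘ ℚᵘ.+ ℚ.toℚᵘ (+ 1 / k)) ℚᵘ.* ℚ.toℚᵘ (+ b / 1)
    ≃⟨ ℚᵘ.*-congʳ {ℚ.toℚᵘ (+ b / 1)} (ℚ.toℚᵘ-homo-+ 1ℚ (+ 1 / k)) ⟨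
  ℚ.toℚᵘ (1ℚ ℚ.+ + 1 / k) ℚᵘ.* ℚ.toℚᵘ (+ b / 1)
    ≃⟨ ℚ.toℚᵘ-homo-* (1ℚ ℚ.+ + 1 / k) (+ b / 1) ⟨
  ℚ.toℚᵘ ((1ℚ ℚ.+ + 1 / k) ℚ.* (+ b / 1)) ∎)
  where
  open ℚᵘ.≤-Reasoning
  cross : + a ℤ.* ℚᵘ.↧ ((ℚᵘ.1ℚᵘ ℚᵘ.+ + 1 ℚᵘ./ k) ℚᵘ.* (+ b ℚᵘ./ 1)) ℤ.≤
          ℚᵘ.↥ ((ℚᵘ.1ℚᵘ ℚᵘ.+ + 1 ℚᵘ./ k) ℚᵘ.* (+ b ℚᵘ./ 1)) ℤ.* + 1
  num : ℚᵘ.↥ ((ℚᵘ.1ℚᵘ ℚᵘ.+ + 1 ℚᵘ./ k) ℚᵘ.* (+ b ℚᵘ./ 1)) ≡ + (suc k * b)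
  num = trans (cong (λ j → + suc j ℤ.* + b) (trans (+-comm (k-1 + 0) 1) (cong suc (+-identityʳ k-1))))
              (sym (ℤ.pos-* (suc k) b))
  den : ℚᵘ.↧ ((ℚᵘ.1ℚᵘ ℚᵘ.+ + 1 ℚᵘ./ k) ℚᵘ.* (+ b ℚᵘ./ 1)) ≡ + k
  den = cong (λ j → + suc j) (trans (*-identityʳ (k-1 + 0)) (+-identityʳ k-1))
  cross = subst₂ (λ d e → + a ℤ.* d ℤ.≤ e ℤ.* + 1) (sym den) (sym num)
    (subst₂ ℤ._≤_ (trans (cong +_ (*-comm k a)) (ℤ.pos-* a k)) (sym (ℤ.*-identityʳ (+ (suc k * b)))) (ℤ.+≤+ ka≤))

size-sum : ∀ {n} (S : Subset n) → ∣ S ∣ ≡ sum (λ v → when (lookup S v) 1)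
size-sum []          = refl
size-sum (true ∷ S)  = cong suc (size-sum S)
size-sum (false ∷ S) = size-sum S

sum-fibre≤1 : ∀ k h → sum {k} (λ i → when (does (h ≟ Fin.toℕ i)) 1) ≤ 1
sum-fibre≤1 zero    h       = z≤n
sum-fibre≤1 (suc k) zero    = ≤-reflexive (cong suc (sum-0 {k} λ _ → refl))
sum-fibre≤1 (suc k) (suc h) = sum-fibre≤1 k h

-- Ties go to the first index: that bounds the index by the number of nodes, so it fits a message.

argmin : (ℕ → ℕ) → ℕ → ℕ
argmin f zero = zero
argmin f (suc m) with f (suc m) <? f (argmin f m)
... | yes _ = suc m
... | no  _ = argmin f m

argmin≤ : ∀ (f : ℕ → ℕ) m → argmin f m ≤ m
argmin≤ f zero = z≤n
argmin≤ f (suc m) with f (suc m) <? f (argmin f m)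
... | yes _ = ≤-refl
... | no  _ = m≤n⇒m≤1+n (argmin≤ f m)

argmin-minimal : ∀ (f : ℕ → ℕ) m j → j ≤ m → f (argmin f m) ≤ f j
argmin-minimal f zero .0 z≤n = ≤-refl
argmin-minimal f (suc m) j j≤1+m with f (suc m) <? f (argmin f m) | m≤n⇒m<n∨m≡n j≤1+m
... | yes lt | inj₁ j<1+m = ≤-trans (<⇒≤ lt) (argmin-minimal f m j (s≤s⁻¹ j<1+m))
... | yes lt | inj₂ refl  = ≤-refl
... | no _   | inj₁ j<1+m = argmin-minimal f m j (s≤s⁻¹ j<1+m)
... | no ≮   | inj₂ refl  = ≮⇒≥ ≮

argmin-first : ∀ (f : ℕ → ℕ) m j → j < argmin f m → f (argmin f m) < f j
argmin-first f (suc m) j j< with f (suc m) <? f (argmin f m)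
... | yes lt = <-≤-trans lt (argmin-minimal f m j (s≤s⁻¹ j<))
... | no _   = argmin-first f m j j<

argmin-cong : ∀ {f g : ℕ → ℕ} m → (∀ j → j ≤ m → f j ≡ g j) → argmin f m ≡ argmin g m
argmin-cong zero eq = refl
argmin-cong {f} {g} (suc m) eq
  with f (suc m) <? f (argmin f m) | g (suc m) <? g (argmin g m)
     | argmin-cong {f} {g} m (λ j j≤m → eq j (m≤n⇒m≤1+n j≤m))
... | yes _ | yes _ | _  = refl
... | no _  | no _  | ih = ih
... | yes lt | no ≮ | ih = contradiction
  (subst₂ _<_ (eq (suc m) ≤-refl) (trans (eq _ (m≤n⇒m≤1+n (argmin≤ f m))) (cong g ih)) lt) ≮
... | no ≮ | yes lt | ih = contradiction
  (subst₂ _<_ (sym (eq (suc m) ≤-refl)) (sym (trans (eq _ (m≤n⇒m≤1+n (argmin≤ f m))) (cong g ih))) lt) ≮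

-- Vertex covers from alternating distances

T⇒≡ : ∀ {b} → T b → b ≡ true
T⇒≡ = Equivalence.to T-≡

≡⇒T : ∀ {b} → b ≡ true → T b
≡⇒T = Equivalence.from T-≡

dec⇒ : ∀ {A : Set} (A? : Dec A) → does A? ≡ true → A
dec⇒ (yes a) _ = a

-- Alternating walks leave the left side along E′ ∖ M and the right side along M.

forward : (left inE′ inM : Bool) → Bool
forward true  e m = e ∧ not m
forward false e m = m

forward-true : ∀ l e m → (m ≡ true → e ≡ true) → forward l e m ≡ true → e ≡ true × m ≡ not l
forward-true true  true false _ _ = refl , refl
forward-true false e    true  m⇒e _ = m⇒e refl , refl

-- On the right, r ≤ 2i + 1 is tested as `⌊ r /2⌋ ≤? i`, so that the cover and the layers refer to
-- the same index.
inCover : (left : Bool) → ℕ → ℕ → Bool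
inCover true  r i = does (2 * i <? r)
inCover false r i = does (⌊ r /2⌋ ≤? i)

-- A matching edge with both ends in the cover is charged to its right end, so left nodes belong to
-- no layer.
inLayer : (left : Bool) → ℕ → ℕ → ℕ
inLayer true  r i = 0
inLayer false r i = when (does (⌊ r /2⌋ ≟ i)) 1

inLayer≤1 : ∀ b r i → inLayer b r i ≤ 1
inLayer≤1 true  r i = z≤n
inLayer≤1 false r i = when-≤ (does (⌊ r /2⌋ ≟ i)) 1

alternate : Bool → ℕ → List Bool
alternate b zero    = []
alternate b (suc m) = b ∷ alternate (not b) m

alternate-linked : ∀ b m → Linked _≢_ (alternate b m)
alternate-linked b 0             = []
alternate-linked b 1             = [-]
alternate-linked b (suc (suc m)) = not-¬ refl ∷ alternate-linked (not b) (suc m)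

module König {n : ℕ} {G : Graph n} (G′ : Subgraph G) (M : EdgeSet n) (matching : IsMatching G′ M)
  (k : ℕ) (no-augmenting : ∀ ℓ → ℓ ≤ 2 * k ∸ 1 → ¬ AugmentingPath M (edges G′) ℓ)
  (left : Fin n → Bool) (proper : ∀ u v → Adj G u v → left u ≢ left v)
  (rank : Fin n → ℕ)
  (rank-0 : ∀ v → rank v ≡ 0 → left v ≡ true × Unmatched M v)
  (unmatched-0 : ∀ v → left v ≡ true → Unmatched M v → rank v ≡ 0)
  (rank-suc : ∀ u v → Adj G u v → forward (left u) (has (edges G′) u v) (has M u v) ≡ true →
              rank u < 2 * k → rank v ≤ suc (rank u))
  (rank-pred : ∀ v {m} → rank v ≤ 2 * k → rank v ≡ suc m →
               ∃[ u ] Adj G u v × forward (left u) (has (edges G′) u v) (has M u v) ≡ true × rank u ≡ m)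
  where

  E′ : EdgeSet n
  E′ = edges G′

  M⇒E′ : ∀ {u v} → Adj M u v → Adj E′ u v
  M⇒E′ = proj₁ matching _ _

  opposite : ∀ {u v} → Adj E′ u v → left v ≡ not (left u)
  opposite {u} {v} e = ¬-not (λ eq → proper u v (edges⊆ G′ u v e) (sym eq))

  opposite-left : ∀ {u v} → Adj E′ u v → left u ≡ false → left v ≡ true
  opposite-left e eq = trans (opposite e) (cong not eq)

  opposite-right : ∀ {u v} → Adj E′ u v → left u ≡ true → left v ≡ false
  opposite-right e eq = trans (opposite e) (cong not eq)

  matched? : ∀ v → Dec (∃[ u ] Adj M v u)
  matched? v = Fin.any? (λ u → T? (has M v u))

  forward⇒ : ∀ u v → Adj G u v → forward (left u) (has E′ u v) (has M u v) ≡ true →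
             Adj E′ v u × has M v u ≡ left v × left u ≡ not (left v)
  forward⇒ u v adj eq
    with forward-true (left u) (has E′ u v) (has M u v) (λ m → T⇒≡ (M⇒E′ (≡⇒T m))) eq
  ... | e , m = Adj-sym E′ (≡⇒T e) , trans (symmetric M v u) (trans m (sym (opposite (≡⇒T e)))) ,
                opposite (Adj-sym E′ (≡⇒T e))

  -- An alternating walk can enter a left node only along its matching edge, so the predecessor of
  -- `a` is its mate.
  left-mate : ∀ {a b} → left a ≡ true → Adj M a b → rank a ≤ 2 * k → rank a ≡ suc (rank b)
  left-mate {a} {b} la m ra≤ = from (rank a) refl
    where
    from : ∀ r → rank a ≡ r → rank a ≡ suc (rank b)
    from zero    eq = contradiction m (proj₂ (rank-0 a eq) b)
    from (suc r) eq with rank-pred a ra≤ eq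
    ... | u , adj , fwd , ru≡r with forward⇒ u a adj fwd
    ...   | _ , flag , _ = trans eq (cong suc (trans (sym ru≡r)
      (cong rank (proj₂ matching a u b (≡⇒T (trans flag la)) m))))

  -- Following predecessors back to rank 0 ends at an unmatched left node. The walk is simple
  -- because the ranks decrease strictly, and alternates because the side of a node decides whether
  -- the edge by which it is entered lies in M.
  descend : ∀ m v → rank v ≡ m → m ≤ 2 * k →
    Σ[ e ∈ Fin n ] Σ[ w ∈ Walk E′ v e m ]
      Unmatched M e × All (λ u → rank u ≤ m) (vertices w) × Unique (vertices w) ×
      matchedFlags M w ≡ alternate (left v) m
  descend zero v eq _ = v , [] , proj₂ (rank-0 v eq) , ≤-reflexive eq ∷ [] , [] ∷ [] , refl
  descend (suc m) v eq m<2k with rank-pred v (≤-trans (≤-reflexive eq) m<2k) eq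
  ... | u , adj , fwd , ru≡m with forward⇒ u v adj fwd | descend m u ru≡m (<⇒≤ m<2k)
  ...   | e , flag , opp | end , w , unmatched , low , unique , flags =
    end , e ∷ w , unmatched ,
    ≤-reflexive eq ∷ All.map m≤n⇒m≤1+n low ,
    All.map (λ { r≤m refl → <⇒≱ (≤-reflexive (sym eq)) r≤m }) low ∷ unique ,
    cong₂ _∷_ flag (trans flags (cong (λ b → alternate b m) opp))

  -- Otherwise the walk of `descend` would be an augmenting path; its length is the rank, at most 2k
  -- - 1, and positive because rank 0 occurs only on the left.
  right-matched : ∀ v → left v ≡ false → rank v < 2 * k → ∃[ u ] Adj M v u
  right-matched v lv r<2k = decidable-stable (matched? v) λ unmatched →
    let end , w , end-unmatched , _ , unique , flags = descend (rank v) v refl (<⇒≤ r<2k) in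
    no-augmenting (rank v) (∸-monoˡ-≤ 1 r<2k) record
      { walk            = w
      ; nonempty        = n≢0⇒n>0 λ r≡0 → contradiction (trans (sym lv) (proj₁ (rank-0 v r≡0))) λ ()
      ; simple          = unique
      ; start-unmatched = λ u m → unmatched (u , m)
      ; end-unmatched   = end-unmatched
      ; alternating     = subst (Linked _≢_) (sym flags) (alternate-linked (left v) (rank v))
      }

  inside : ℕ → Fin n → Bool
  inside i v = inCover (left v) (rank v) i

  suc2i<2k : ∀ {i} → i < k → suc (2 * i) < 2 * k
  suc2i<2k {i} i<k = ≤-trans (≤-reflexive (sym (*-suc 2 i))) (*-monoʳ-≤ 2 i<k)

  inside-right : ∀ {i v} → left v ≡ false → inside i v ≡ true → rank v ≤ suc (2 * i)
  inside-right {i} {v} lv eq rewrite lv = half-≤⁻¹ _ i (dec⇒ (⌊ rank v /2⌋ ≤? i) eq)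

  right-inside : ∀ {i v} → left v ≡ false → rank v ≤ suc (2 * i) → inside i v ≡ true
  right-inside {i} {v} lv r≤ rewrite lv = dec-true (⌊ rank v /2⌋ ≤? i) (half-≤ _ i r≤)

  inside-left : ∀ {i v} → left v ≡ true → inside i v ≡ true → 2 * i < rank v
  inside-left {i} {v} lv eq rewrite lv = dec⇒ (2 * i <? rank v) eq

  inside-matched : ∀ {i} → i < k → ∀ v → inside i v ≡ true → ∃[ u ] Adj M v u
  inside-matched {i} i<k v eq = by (left v) refl
    where
    by : ∀ b → left v ≡ b → ∃[ u ] Adj M v u
    -- No augmenting path is needed on this side: an unmatched left node has rank 0, which is not
    -- above 2i.
    by true  lv = decidable-stable (matched? v) λ unmatched →
      contradiction (≤-trans (inside-left lv eq) (≤-reflexive (unmatched-0 v lv λ u m → unmatched (u , m)))) λ ()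
    by false lv = right-matched v lv (≤-<-trans (inside-right {i} lv eq) (suc2i<2k i<k))

  -- Only rank a ≤ 2i needs an argument. If the edge is in M, then `a` was entered through `b`,
  -- which has smaller rank; if not, the edge can be walked from `a`, so `b` has rank at most 2i +
  -- 1.
  edge-left : ∀ {i} → i < k → ∀ a b → Adj E′ a b → left a ≡ true →
              inside i a ≡ true ⊎ inside i b ≡ true
  edge-left {i} i<k a b e la with 2 * i <? rank a
  ... | yes 2i<r = inj₁ (trans (cong (λ l → inCover l (rank a) i) la) (dec-true (2 * i <? rank a) 2i<r))
  ... | no 2i≮r = inj₂ (right-inside (opposite-right e la) (low (has M a b) refl))
    where
    ra≤2i : rank a ≤ 2 * i
    ra≤2i = ≮⇒≥ 2i≮r
    ra<2k : rank a < 2 * k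
    ra<2k = ≤-<-trans ra≤2i (≤-<-trans (n≤1+n _) (suc2i<2k i<k))
    low : ∀ m → has M a b ≡ m → rank b ≤ suc (2 * i)
    low true  eq = begin
      rank b        ≤⟨ n≤1+n _ ⟩
      suc (rank b)  ≡⟨ left-mate la (≡⇒T eq) (<⇒≤ ra<2k) ⟨
      rank a        ≤⟨ ra≤2i ⟩
      2 * i         ≤⟨ n≤1+n _ ⟩
      suc (2 * i)   ∎
      where open ≤-Reasoning
    low false eq = ≤-trans (rank-suc a b (edges⊆ G′ a b e) fwd ra<2k) (s≤s ra≤2i)
      where
      fwd : forward (left a) (has E′ a b) (has M a b) ≡ true
      fwd rewrite la | T⇒≡ e | eq = refl

  edge-covered : ∀ {i} → i < k → ∀ u v → Adj E′ u v → inside i u ≡ true ⊎ inside i v ≡ true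
  edge-covered i<k u v e = by (left u) refl
    where
    by : ∀ b → left u ≡ b → inside _ u ≡ true ⊎ inside _ v ≡ true
    by true  lu = edge-left i<k u v e lu
    by false lu = swap (edge-left i<k v u (Adj-sym E′ e) (opposite-left e lu))

  -- Fixing the unmatched nodes makes this an involution on all nodes, hence a permutation under
  -- which sums can be reindexed.
  mate : Fin n → Fin n
  mate v with matched? v
  ... | yes (u , _) = u
  ... | no  _       = v

  mate-adjacent : ∀ {v u} → Adj M v u → mate v ≡ u
  mate-adjacent {v} {u} m with matched? v
  ... | yes (w , m′)  = proj₂ matching v w u m′ m
  ... | no unmatched = contradiction (u , m) unmatched

  mate-unmatched : ∀ {v} → ¬ (∃[ u ] Adj M v u) → mate v ≡ v
  mate-unmatched {v} unmatched with matched? v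
  ... | yes m = contradiction m unmatched
  ... | no _  = refl

  mate-involutive : ∀ v → mate (mate v) ≡ v
  mate-involutive v = by (matched? v)
    where
    by : Dec (∃[ u ] Adj M v u) → mate (mate v) ≡ v
    by (yes (u , m)) = trans (cong mate (mate-adjacent m)) (mate-adjacent (Adj-sym M m))
    by (no unmatched) = trans (cong mate (mate-unmatched unmatched)) (mate-unmatched unmatched)

  onLeft onRight : (Fin n → ℕ) → Fin n → ℕ
  onLeft  f v = when (left v) (f v)
  onRight f v = when (not (left v)) (f v)

  -- Shifting the left part along the matching turns a sum over V into a sum over right nodes.
  sum-along-mate : ∀ f → sum f ≡ sum (λ v → onLeft f (mate v) + onRight f v)
  sum-along-mate f = begin
    sum f                                          ≡⟨ sum-cong-≗ split ⟩
    sum (λ v → onLeft f v + onRight f v)           ≡⟨ ∑-distrib-+ (onLeft f) (onRight f) ⟩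
    sum (onLeft f) + sum (onRight f)               ≡⟨ cong (_+ sum (onRight f)) (sum-permute (onLeft f) π) ⟩
    sum (λ v → onLeft f (mate v)) + sum (onRight f) ≡⟨ ∑-distrib-+ (λ v → onLeft f (mate v)) (onRight f) ⟨
    sum (λ v → onLeft f (mate v) + onRight f v)    ∎
    where
    open ≡-Reasoning
    π : Permutation n n
    π = permutation mate mate mate-involutive mate-involutive
    split : ∀ v → f v ≡ onLeft f v + onRight f v
    split v with left v
    ... | true  = sym (+-identityʳ (f v))
    ... | false = refl

  -- Its sum is |M|, since every matching edge has exactly one right end.
  matchedRight : Fin n → ℕ
  matchedRight = onRight (λ v → when (does (matched? v)) 1)

  matchedRight≤1 : ∀ v → matchedRight v ≤ 1
  matchedRight≤1 v = ≤-trans (when-≤ (not (left v)) _) (when-≤ (does (matched? v)) 1)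

  layer : ℕ → Fin n → ℕ
  layer i v = inLayer (left v) (rank v) i

  indicator : (Fin n → Bool) → Fin n → ℕ
  indicator s v = when (s v) 1

  matchedRight-yes : ∀ {v u} → left v ≡ false → Adj M v u → matchedRight v ≡ 1
  matchedRight-yes {v} {u} lv m rewrite lv | dec-true (matched? v) (u , m) = refl

  -- Let v on the right be matched to u. If both are in the cover, then 2i < rank u = rank v + 1
  -- gives i ≤ ⌊rank v / 2⌋, and membership of v gives the converse inequality. So the second node
  -- is paid for by layer i. Unmatched nodes contribute nothing.
  size-bound : ∀ {i} → i < k → sum (indicator (inside i)) ≤ sum matchedRight + sum (layer i)
  size-bound {i} i<k = begin
    sum (indicator (inside i))                ≡⟨ sum-along-mate (indicator (inside i)) ⟩
    sum (λ v → onLeft (indicator (inside i)) (mate v) + onRight (indicator (inside i)) v)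
                                              ≤⟨ sum-mono pointwise ⟩
    sum (λ v → matchedRight v + layer i v)    ≡⟨ ∑-distrib-+ matchedRight (layer i) ⟩
    sum matchedRight + sum (layer i)          ∎
    where
    open ≤-Reasoning
    pointwise : ∀ v → onLeft (indicator (inside i)) (mate v) + onRight (indicator (inside i)) v
                      ≤ matchedRight v + layer i v
    pointwise v = by (matched? v) (left v) refl
      where
      by : Dec (∃[ u ] Adj M v u) → ∀ b → left v ≡ b →
           onLeft (indicator (inside i)) (mate v) + onRight (indicator (inside i)) v
           ≤ matchedRight v + layer i v
      by (no unmatched) _ _ rewrite mate-unmatched unmatched
        | ¬-not (λ eq → unmatched (inside-matched i<k v eq))
        | when-0 (left v) | when-0 (not (left v)) = z≤n
      by (yes (u , m)) true  lv rewrite mate-adjacent m | lv | opposite-right (M⇒E′ m) lv = z≤n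
      by (yes (u , m)) false lv rewrite mate-adjacent m | matchedRight-yes lv m | lv
        | opposite-left (M⇒E′ m) lv = pair (2 * i <? rank u) (⌊ rank v /2⌋ ≤? i)
        where
        fwd : forward (left v) (has E′ v u) (has M v u) ≡ true
        fwd = trans (cong (λ l → forward l (has E′ v u) (has M v u)) lv) (T⇒≡ m)
        i≤half : 2 * i < rank u → ⌊ rank v /2⌋ ≤ i → i ≤ ⌊ rank v /2⌋
        i≤half 2i<r h≤i = half-≥ _ i (s≤s⁻¹ (≤-trans 2i<r (≤-reflexive
          (left-mate (opposite-left (M⇒E′ m) lv) (Adj-sym M m)
            (≤-trans (rank-suc v u (edges⊆ G′ v u (M⇒E′ m)) fwd rv<2k) rv<2k)))))
          where
          rv<2k : rank v < 2 * k
          rv<2k = ≤-<-trans (half-≤⁻¹ _ i h≤i) (suc2i<2k i<k)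
        pair : Dec (2 * i < rank u) → Dec (⌊ rank v /2⌋ ≤ i) →
          when (does (2 * i <? rank u)) 1 + when (does (⌊ rank v /2⌋ ≤? i)) 1
          ≤ 1 + when (does (⌊ rank v /2⌋ ≟ i)) 1
        pair (no ≮)  _ rewrite dec-false (2 * i <? rank u) ≮ =
          ≤-trans (when-≤ (does (⌊ rank v /2⌋ ≤? i)) 1) (m≤m+n 1 _)
        pair (yes _) (no ≰) rewrite dec-false (⌊ rank v /2⌋ ≤? i) ≰ =
          ≤-trans (≤-reflexive (+-identityʳ _)) (≤-trans (when-≤ (does (2 * i <? rank u)) 1) (m≤m+n 1 _))
        pair (yes 2i<r) (yes h≤i)
          rewrite dec-true (⌊ rank v /2⌋ ≟ i) (≤-antisym h≤i (i≤half 2i<r h≤i)) =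
          +-mono-≤ (when-≤ (does (2 * i <? rank u)) 1) (when-≤ (does (⌊ rank v /2⌋ ≤? i)) 1)

  -- Weak duality: the edges of M are disjoint, and each contains a node of `s`.
  matching≤cover : ∀ s → (∀ u v → Adj E′ u v → s u ≡ true ⊎ s v ≡ true) →
                   sum matchedRight ≤ sum (indicator s)
  matching≤cover s covers = begin
    sum matchedRight                                                ≤⟨ sum-mono pointwise ⟩
    sum (λ v → onLeft (indicator s) (mate v) + onRight (indicator s) v) ≡⟨ sum-along-mate (indicator s) ⟨
    sum (indicator s)                                               ∎
    where
    open ≤-Reasoning
    pointwise : ∀ v → matchedRight v ≤ onLeft (indicator s) (mate v) + onRight (indicator s) v
    pointwise v = by (matched? v) (left v) refl
      where
      by : Dec (∃[ u ] Adj M v u) → ∀ b → left v ≡ b →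
           matchedRight v ≤ onLeft (indicator s) (mate v) + onRight (indicator s) v
      by (no unmatched) _ _ rewrite dec-false (matched? v) unmatched | when-0 (not (left v)) = z≤n
      by (yes _) true lv rewrite lv = z≤n
      by (yes (u , m)) false lv rewrite matchedRight-yes lv m | mate-adjacent m | lv
        | opposite-left (M⇒E′ m) lv with covers u v (Adj-sym E′ (M⇒E′ m))
      ... | inj₁ su rewrite su = s≤s z≤n
      ... | inj₂ sv rewrite sv = m≤n+m 1 _

  -- A right node has only one value ⌊rank / 2⌋, and an unmatched one has rank at least 2k, beyond
  -- the first k layers. The general `K` serves both the averaging over all k layers and the bound
  -- on `best`.
  layers-disjoint : ∀ K → K ≤ k → sum {K} (λ i → sum (layer (Fin.toℕ i))) ≤ sum matchedRight
  layers-disjoint K K≤k = begin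
    sum {K} (λ i → sum (λ v → layer (Fin.toℕ i) v))    ≡⟨ ∑-comm {K} (λ i v → layer (Fin.toℕ i) v) ⟩
    sum (λ v → sum {K} λ i → layer (Fin.toℕ i) v)      ≤⟨ sum-mono pointwise ⟩
    sum matchedRight                                   ∎
    where
    open ≤-Reasoning
    pointwise : ∀ v → sum {K} (λ i → layer (Fin.toℕ i) v) ≤ matchedRight v
    pointwise v = by (matched? v) (left v) refl
      where
      by : Dec (∃[ u ] Adj M v u) → ∀ b → left v ≡ b →
           sum {K} (λ i → layer (Fin.toℕ i) v) ≤ matchedRight v
      by _ true lv rewrite lv = ≤-reflexive (sum-0 {K} λ _ → refl)
      by (yes (u , m)) false lv rewrite matchedRight-yes lv m | lv = sum-fibre≤1 K ⌊ rank v /2⌋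
      by (no unmatched) false lv = ≤-trans (≤-reflexive (sum-0 {K} outside)) z≤n
        where
        outside : ∀ (i : Fin K) → layer (Fin.toℕ i) v ≡ 0
        outside i = trans (cong (λ l → inLayer l (rank v) (Fin.toℕ i)) lv)
          (cong (λ b → when b 1) (dec-false (⌊ rank v /2⌋ ≟ Fin.toℕ i) λ h≡i →
          unmatched (right-matched v lv (≤-<-trans (half-≤⁻¹ _ (Fin.toℕ i) (≤-reflexive h≡i))
            (suc2i<2k (<-≤-trans (Fin.toℕ<n i) K≤k))))))

  layerSize : ℕ → ℕ
  layerSize i = sum (layer i)

  best : ℕ
  best = argmin layerSize (pred k)

  module _ .{{k≢0 : NonZero k}} where

    best<k : best < k
    best<k = ≤-<-trans (argmin≤ _ (pred k)) (≤-reflexive (suc-pred k))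

    -- Every layer before the first least one is strictly larger than it, hence nonempty, and the
    -- layers are disjoint.
    best≤n : best ≤ n
    best≤n = begin
      best                                                 ≡⟨ *-identityʳ best ⟨
      best * 1
        ≤⟨ sum-≥ {best} (λ i → ≤-trans (s≤s z≤n)
             (argmin-first layerSize (pred k) (Fin.toℕ i) (Fin.toℕ<n i))) ⟩
      sum {best} (λ i → sum (layer (Fin.toℕ i)))           ≤⟨ layers-disjoint best (<⇒≤ best<k) ⟩
      sum matchedRight                                     ≤⟨ sum-≤1 matchedRight≤1 ⟩
      n                                                    ∎
      where open ≤-Reasoning

    cover : Subset n
    cover = tabulate (inside best)

    ∈cover : ∀ {v} → inside best v ≡ true → v ∈ cover
    ∈cover {v} eq = lookup⇒[]= v cover (trans (lookup∘tabulate (inside best) v) eq)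

    cover-isVertexCover : IsVertexCover G′ cover
    cover-isVertexCover =
      (λ {v} v∈ → let u , m = inside-matched best<k v (trans (sym (lookup∘tabulate (inside best) v)) ([]=⇒lookup v∈))
                  in endpoints G′ v u (M⇒E′ m)) ,
      λ u v e → Sum.map ∈cover ∈cover (edge-covered best<k u v e)

    cover-size : ∀ S → IsVertexCover G′ S → k * ∣ cover ∣ ≤ suc k * ∣ S ∣
    cover-size S (_ , covers) = begin
      k * ∣ cover ∣
        ≡⟨ cong (k *_) (trans (size-sum cover)
             (sum-cong-≗ λ v → cong (λ b → when b 1) (lookup∘tabulate (inside best) v))) ⟩
      k * sum (indicator (inside best))
        ≤⟨ *-monoʳ-≤ k (size-bound best<k) ⟩
      k * (m + layerSize best)
        ≡⟨ *-distribˡ-+ k m (layerSize best) ⟩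
      k * m + k * layerSize best
        -- Averaging: the chosen layer is no larger than any of the k layers, so k copies of it fit
        -- into their sum.
        ≤⟨ +-monoʳ-≤ (k * m) (sum-≥ {k} λ i → argmin-minimal layerSize (pred k) (Fin.toℕ i)
             (s≤s⁻¹ (≤-trans (Fin.toℕ<n i) (≤-reflexive (sym (suc-pred k)))))) ⟩
      k * m + sum {k} (λ i → layerSize (Fin.toℕ i))
        ≤⟨ +-monoʳ-≤ (k * m) (layers-disjoint k ≤-refl) ⟩
      k * m + m
        ≡⟨ +-comm (k * m) m ⟩
      suc k * m
        ≤⟨ *-monoʳ-≤ (suc k) (matching≤cover (lookup S) λ u v e →
             Sum.map []=⇒lookup []=⇒lookup (covers u v e)) ⟩
      suc k * sum (indicator (lookup S))
        ≡⟨ cong (suc k *_) (size-sum S) ⟨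
      suc k * ∣ S ∣ ∎
      where
      open ≤-Reasoning
      m : ℕ
      m = sum matchedRight

    cover-approximate : IsApproximateVertexCover G′ (1ℚ ℚ.+ + 1 / k) cover
    cover-approximate = cover-isVertexCover , λ S* minimum →
      ratio-≤ ∣ cover ∣ ∣ S* ∣ k (cover-size S* (proj₁ minimum))

-- The program of a phase

even : ℕ → Bool
even zero    = true
even (suc m) = not (even m)

unmatched : ∀ {d} → NodeInput d → Bool
unmatched i = does (¬? (Fin.any? λ p → T? (NodeInput.inM i p)))

idle : ∀ {d} → ℕ → Prog d (Maybe Bool)
idle L = iterate (λ _ _ _ → 0) (λ _ x _ → x) 0 L nothing

coverProgram : ∀ {d} → ℕ → NodeInput d → ℕ → ℕ → Prog d (Maybe Bool)
coverProgram k i T leader =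
  bfs (does (ident i ≟ leader)) (λ _ → true) T >>= λ x →
  let depth = proj₁ x ; left = even depth in
  bfs (left ∧ unmatched i) (λ p → forward left (inE′ i p) (inM i p)) (2 * k) >>= λ y →
  convergecast T depth (proj₂ x) (inLayer left (proj₁ y)) (k + T) >>= λ z →
  -- The sum of index j reaches the root in round j + T. All nodes but the leader enter with 0, so
  -- the maximum is the leader's choice.
  flood _⊔_ T (when (does (depth ≟ 0)) (argmin (λ j → proj₂ z (j + T)) (pred k))) >>= λ j →
  return (just (inCover left (proj₁ y) j))
  where open NodeInput

coverRounds : ℕ → ℕ → ℕ
coverRounds k T = T + (2 * k + ((k + T) + (T + 0)))

-- The nodes within distance 2T + 1 have equal labels iff the leader's ball of radius T is
-- the whole graph. Idling gives all phases with the same guess the same length.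

phase : ∀ {d} → ℕ → NodeInput d → ℕ → Prog d (Maybe Bool)
phase k i T =
  flood _⊓_ T (NodeInput.ident i) >>= λ label →
  flood _⊔_ (suc (2 * T)) label >>= λ high →
  flood _⊓_ (suc (2 * T)) label >>= λ low →
  if does (high ≟ low) then coverProgram k i T label else idle (coverRounds k T)

phaseRounds : ℕ → ℕ → ℕ
phaseRounds k T = T + (suc (2 * T) + (suc (2 * T) + coverRounds k T))

-- Correctness of election and cover

module Correctness (c : ℕ) {n : ℕ} (G : Graph n) (bipartite : Bipartite G) (D : ℕ)
  (diameter : Diameter G D) (G′ : Subgraph G) (k : ℕ) .{{k≢0 : NonZero k}}
  (M : EdgeSet n) (matching : IsMatching G′ M)
  (no-augmenting : ∀ ℓ → ℓ ≤ 2 * k ∸ 1 → ¬ AugmentingPath M (edges G′) ℓ)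
  (P : Ports G) (ids : Identifiers c n) where

  open Ports P
  open PortLemmas P
  open Identifiers ids

  -- Identifiers take c ⌈log₂ n⌉ bits. Numbers up to n must lie strictly below the bound, and n may
  -- equal 2 ^ ⌈log₂ n⌉; hence the summand 2.
  B : ℕ
  B = (c + 2) * ⌈log₂ n ⌉

  bound : ℕ
  bound = 2 ^ B

  input : ∀ v → NodeInput (degree v)
  input = nodeInput P ids G′ M

  open Network P bound
  open Primitives P bound

  -- A port supplies two distinct nodes, so ⌈log₂ n⌉ is positive. In a one-node graph the bound is 1
  -- and the inequality would fail, but nothing is sent there.
  n<bound : ∀ v → Fin (degree v) → n < bound
  n<bound v p = begin-strict
    n                  ≤⟨ n≤2^⌈log₂n⌉ n ⟩
    2 ^ ⌈log₂ n ⌉      <⟨ ^-monoʳ-< 2 ≤-refl (m<m+n ⌈log₂ n ⌉ (≤-trans (⌈log₂⌉-mono-≤ {2} 2≤n) (m≤m+n _ 0))) ⟩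
    2 ^ (2 * ⌈log₂ n ⌉) ≤⟨ ^-monoʳ-≤ 2 (*-monoˡ-≤ ⌈log₂ n ⌉ (m≤n+m 2 c)) ⟩
    bound              ∎
    where
    open ≤-Reasoning
    distinct : ∀ {n} (u v : Fin n) → u ≢ v → 2 ≤ n
    distinct {suc (suc n)} u v _ = s≤s (s≤s z≤n)
    distinct {suc zero} zero zero u≢v = contradiction refl u≢v
    2≤n : 2 ≤ n
    2≤n = distinct v (neighbour v p) λ eq →
      contradiction (subst (Adj G v) (sym eq) (adjacent v p)) (subst (¬_ ∘ T) (sym (loopless G v)) λ ())

  ≤n<bound : ∀ {m} → m ≤ n → ∀ v → Fin (degree v) → m < bound
  ≤n<bound m≤n v p = ≤-<-trans m≤n (n<bound v p)

  ident<bound : ∀ u → ident u < bound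
  ident<bound u = <-≤-trans (bit-bound u) (^-monoʳ-≤ 2 (*-monoˡ-≤ ⌈log₂ n ⌉ (m≤m+n c 2)))

  1<bound : ∀ v → Fin (degree v) → 1 < bound
  1<bound v = ≤n<bound (nonempty v) v
    where
    nonempty : ∀ {n} → Fin n → 1 ≤ n
    nonempty {suc _} _ = s≤s z≤n

  -- Weaker than D ≤ T: a guess below the diameter may succeed, and the cover stage needs only a
  -- leader within distance T of every node.
  record Elected (T : ℕ) (label : Fin n → ℕ) : Set where
    field
      leader : Fin n
      agreed : ∀ v → label v ≡ ident leader
      near   : ∀ v → ∃[ ℓ ] ℓ ≤ T × Walk G v leader ℓ

  flooded-bound : ∀ {_≼_ L} {x y : Fin n → ℕ} → Flooded _≼_ L x y →
                  (∀ u → x u < bound) → ∀ u → y u < bound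
  flooded-bound (attained , _) x< u with attained u
  ... | w , _ , _ , _ , eq = subst (_< bound) (sym eq) (x< w)

  module Election (T : ℕ) {label high low : Fin n → ℕ}
    (labels : Flooded _≤_ T ident label)
    (highs : Flooded _≥_ (suc (2 * T)) label high)
    (lows : Flooded _≤_ (suc (2 * T)) label low) where

    -- A single node certifies the whole graph. By induction along a walk from the leader: a node
    -- adjacent to one within T of the leader is within 2T + 1 of `v`, so it has the label of `v`;
    -- as identifiers are unique, that label came from the leader, which is therefore within T of it
    -- too.
    elected : ∀ v → high v ≡ low v → Elected T label
    elected v eq with proj₁ labels v
    ... | leader , ℓ₀ , ℓ₀≤T , v→leader , leads =
      record { leader = leader ; agreed = agreed ; near = near }
      where
      same : ∀ {u ℓ} → Walk G v u ℓ → ℓ ≤ suc (2 * T) → label u ≡ label v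
      same w ℓ≤ = ≤-antisym
        (≤-trans (proj₂ highs w ℓ≤) (≤-trans (≤-reflexive eq) (proj₂ lows [] z≤n)))
        (≤-trans (proj₂ highs [] z≤n) (≤-trans (≤-reflexive eq) (proj₂ lows w ℓ≤)))

      close : ∀ {u ℓ} → Walk G v u ℓ → ℓ ≤ suc (2 * T) → ∃[ m ] m ≤ T × Walk G u leader m
      close {u} w ℓ≤ with proj₁ labels u
      ... | a , m , m≤T , w′ , lab with unique (trans (sym lab) (trans (same w ℓ≤) leads))
      ...   | refl = m , m≤T , w′

      near : ∀ u → ∃[ ℓ ] ℓ ≤ T × Walk G u leader ℓ
      near u with proj₁ diameter u leader
      ... | _ , (w , _) , _ = along w
        where
        along : ∀ {u ℓ} → Walk G u leader ℓ → ∃[ m ] m ≤ T × Walk G u leader m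
        along [] = 0 , z≤n , []
        along (e ∷ w) with along w
        ... | m , m≤T , w′ =
          close (v→leader ++ʷ reverseWalk (e ∷ w′)) (begin
            ℓ₀ + suc m   ≡⟨ +-suc ℓ₀ m ⟩
            suc (ℓ₀ + m) ≤⟨ s≤s (+-mono-≤ ℓ₀≤T (≤-trans m≤T (m≤m+n T 0))) ⟩
            suc (2 * T)  ∎)
          where open ≤-Reasoning

      agreed : ∀ u → label u ≡ ident leader
      agreed u with near u
      ... | m , m≤T , w =
        trans (same (v→leader ++ʷ reverseWalk w)
          (m≤n⇒m≤1+n (+-mono-≤ ℓ₀≤T (≤-trans m≤T (m≤m+n T 0))))) leads

    elected⇒equal : Elected T label → ∀ v → high v ≡ low v
    elected⇒equal e v with proj₁ highs v | proj₁ lows v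
    ... | a , _ , _ , _ , h | b , _ , _ , _ , l = trans h (trans (agreed a) (trans (sym (agreed b)) (sym l)))
      where open Elected e

    wide : D ≤ T → ∀ u v → label u ≤ label v
    wide D≤T u v with proj₁ labels v
    ... | a , _ , _ , _ , lab with proj₁ diameter u a
    ...   | _ , (w , _) , ℓ≤D = ≤-trans (proj₂ labels w (≤-trans ℓ≤D D≤T)) (≤-reflexive (sym lab))

    wide⇒equal : D ≤ T → ∀ v → high v ≡ low v
    wide⇒equal D≤T v with proj₁ highs v | proj₁ lows v
    ... | a , _ , _ , _ , h | b , _ , _ , _ , l =
      trans h (trans (≤-antisym (wide D≤T a b) (wide D≤T b a)) (sym l))

    -- Equality at one node gives `Elected`, which gives equality at every node. Hence all nodes
    -- branch alike and stay in step.
    decision : Elected T label × (∀ v → high v ≡ low v) ⊎ (∀ v → high v ≢ low v) × T < D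
    decision = by (high v₀ ≟ low v₀)
      where
      v₀ : Fin n
      v₀ = proj₁ (proj₂ diameter)
      by : Dec (high v₀ ≡ low v₀) →
           Elected T label × (∀ v → high v ≡ low v) ⊎ (∀ v → high v ≢ low v) × T < D
      by (yes eq) = inj₁ (elected v₀ eq , elected⇒equal (elected v₀ eq))
      by (no neq) = inj₂ ((λ v eq → neq (elected⇒equal (elected v eq) v₀)) ,
                          ≰⇒> λ D≤T → neq (wide⇒equal D≤T v₀))

  Covers : (Fin n → Maybe Bool) → Set
  Covers a = ∃[ S ] (∀ v → a v ≡ just (lookup S v)) × IsApproximateVertexCover G′ (1ℚ ℚ.+ + 1 / k) S

  side : Fin n → Bool
  side = proj₁ bipartite

  module CoverStage (T : ℕ) (label : Fin n → ℕ) (isElected : Elected T label) where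
    open Elected isElected

    isLeader : Fin n → Bool
    isLeader v = does (ident v ≟ label v)

    everywhere : ∀ v → Fin (degree v) → Bool
    everywhere _ _ = true

    module Depths (x : ∀ v → ℕ × Maybe (Fin (degree v))) (ranked : Ranked isLeader everywhere T x) where
      open Ranked ranked public

      depth : Fin n → ℕ
      depth = rank

      leader-depth : depth leader ≡ 0
      leader-depth = source⇒0 leader (dec-true (ident leader ≟ label leader) (sym (agreed leader)))

      walk-depth : ∀ {v ℓ} → Walk G v leader ℓ → ℓ ≤ T → depth v ≤ ℓ
      walk-depth [] _ = ≤-reflexive leader-depth
      walk-depth {v} (e ∷ w) ℓ<T with portTo e
      ... | p , refl = ≤-trans (rank-suc v p refl (≤-<-trans shorter ℓ<T)) (s≤s shorter)
        where shorter = walk-depth w (<⇒≤ ℓ<T)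

      depth≤T : ∀ v → depth v ≤ T
      depth≤T v with near v
      ... | ℓ , ℓ≤T , w = ≤-trans (walk-depth w ℓ≤T) ℓ≤T

      leader-unique : ∀ v → depth v ≡ 0 → v ≡ leader
      leader-unique v eq = unique (trans (dec⇒ (ident v ≟ label v) (0⇒source v eq)) (agreed v))

      parent-depth : ∀ v {m} → depth v ≡ suc m →
                     ∃[ p ] proj₂ (x v) ≡ just p × depth (neighbour v p) ≡ m
      parent-depth v eq with rank-pred v (depth≤T v) eq
      ... | p , parent , below , _ = p , parent , below

      left : Fin n → Bool
      left v = even (depth v)

      sideAt : Bool → Bool
      sideAt l = if l then side leader else not (side leader)

      -- The step to the parent flips both the side and the parity. So parity, which the nodes can
      -- compute, agrees with the given bipartition up to a swap.
      side-parity : ∀ m v → depth v ≡ m → side v ≡ sideAt (even m)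
      side-parity zero    v eq = cong side (leader-unique v eq)
      side-parity (suc m) v eq with parent-depth v eq
      ... | p , _ , below = begin
        side v                   ≡⟨ ¬-not (proj₂ bipartite v (neighbour v p) (adjacent v p)) ⟩
        not (side (neighbour v p)) ≡⟨ cong not (side-parity m (neighbour v p) below) ⟩
        not (sideAt (even m))    ≡⟨ flip (even m) ⟩
        sideAt (even (suc m))    ∎
        where
        open ≡-Reasoning
        flip : ∀ l → not (sideAt l) ≡ sideAt (not l)
        flip true  = refl
        flip false = not-involutive (side leader)

      proper : ∀ u v → Adj G u v → left u ≢ left v
      proper u v e eq = proj₂ bipartite u v e (begin
        side u           ≡⟨ side-parity (depth u) u refl ⟩
        sideAt (left u)  ≡⟨ cong sideAt eq ⟩
        sideAt (left v)  ≡⟨ side-parity (depth v) v refl ⟨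
        side v           ∎)
        where open ≡-Reasoning

      source : Fin n → Bool
      source v = left v ∧ unmatched (input v)

      out : ∀ v → Fin (degree v) → Bool
      out v p = forward (left v) (NodeInput.inE′ (input v) p) (NodeInput.inM (input v) p)

      unmatched⇒ : ∀ v → unmatched (input v) ≡ true → Unmatched M v
      unmatched⇒ v eq u m with portTo (edges⊆ G′ v u (proj₁ matching v u m))
      ... | p , refl = dec⇒ (¬? (Fin.any? λ p → T? (NodeInput.inM (input v) p))) eq (p , m)

      unmatched⇐ : ∀ v → Unmatched M v → unmatched (input v) ≡ true
      unmatched⇐ v un = dec-true (¬? (Fin.any? λ p → T? (NodeInput.inM (input v) p)))
                          λ (p , m) → un (neighbour v p) m

      module Layers (y : ∀ v → ℕ × Maybe (Fin (degree v))) (layered : Ranked source out (2 * k) y) where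
        module R = Ranked layered

        level : Fin n → ℕ
        level = R.rank

        allowed : Fin n → Fin n → Bool
        allowed u v = forward (left u) (has (edges G′) u v) (has M u v)

        out≡ : ∀ v p → out (neighbour v p) (reverse v p) ≡ allowed (neighbour v p) v
        out≡ v p = cong (allowed (neighbour v p)) (neighbour-reverse v p)

        level-0 : ∀ v → level v ≡ 0 → left v ≡ true × Unmatched M v
        level-0 v eq with left v | R.0⇒source v eq
        ... | true | un = refl , unmatched⇒ v un

        unmatched-0 : ∀ v → left v ≡ true → Unmatched M v → level v ≡ 0
        unmatched-0 v lv un = R.source⇒0 v (cong₂ _∧_ lv (unmatched⇐ v un))

        level-suc : ∀ u v → Adj G u v → allowed u v ≡ true → level u < 2 * k → level v ≤ suc (level u)
        level-suc u v e fwd u<2k with portTo (Adj-sym G e)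
        ... | p , refl = R.rank-suc v p (trans (out≡ v p) fwd) u<2k

        level-pred : ∀ v {m} → level v ≤ 2 * k → level v ≡ suc m →
                     ∃[ u ] Adj G u v × allowed u v ≡ true × level u ≡ m
        level-pred v v≤2k eq with R.rank-pred v v≤2k eq
        ... | p , _ , below , o =
          neighbour v p , Adj-sym G (adjacent v p) , trans (sym (out≡ v p)) o , below

        open König G′ M matching k no-augmenting left proper level level-0 unmatched-0 level-suc level-pred public

        own : Fin n → ℕ → ℕ
        own v = inLayer (left v) (level v)

        open Convergecast P bound depth (λ v → proj₂ (x v)) T depth≤T leader leader-depth leader-unique
          parent-depth own (λ v → inLayer≤1 (left v) (level v)) n<bound public

        share-shift : ∀ v i → shareOf v (i + T) ≡ own v i
        share-shift v i rewrite dec-true (T ≤? i + T) (m≤n+m T i) | m+n∸n≡m i T = refl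

        module Choice (z : Fin n → ℕ × (ℕ → ℕ)) (totals : Totals (k + T) z) where

          candidate : Fin n → ℕ
          candidate v = when (does (depth v ≟ 0)) (argmin (λ j → proj₂ (z v) (j + T)) (pred k))

          leader-argmin : argmin (λ j → proj₂ (z leader) (j + T)) (pred k) ≡ best
          leader-argmin = argmin-cong (pred k) λ j j≤ → trans
            (totals (j + T) (+-monoˡ-< T (≤-<-trans j≤ (≤-reflexive (suc-pred k)))))
            (sum-cong-≗ λ v → share-shift v j)

          leader-candidate : candidate leader ≡ best
          leader-candidate rewrite dec-true (depth leader ≟ 0) leader-depth = leader-argmin

          candidate≤best : ∀ v → candidate v ≤ best
          candidate≤best v with depth v ≟ 0
          ... | yes eq rewrite leader-unique v eq = ≤-reflexive leader-candidate
          ... | no neq rewrite dec-false (depth v ≟ 0) neq = z≤n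

          candidate<bound : ∀ v → Fin (degree v) → ∀ u → candidate u < bound
          candidate<bound v p u = ≤n<bound (≤-trans (candidate≤best u) best≤n) v p

          chosen : ∀ j → Flooded _≥_ T candidate j → ∀ v → j v ≡ best
          chosen j (attained , upper) v with attained v | near v
          ... | u , _ , _ , _ , eq | ℓ , ℓ≤T , w = ≤-antisym
            (≤-trans (≤-reflexive eq) (candidate≤best u))
            (≤-trans (≤-reflexive (sym leader-candidate)) (upper w ℓ≤T))

    achieves-cover : Achieves (coverRounds k T) (λ v → coverProgram k (input v) T (label v)) Covers
    achieves-cover =
      achieves->>= T _ (achieves-bfs 1<bound isLeader everywhere T) λ x ranked →
      let open Depths x ranked in
      achieves->>= (2 * k) _ (achieves-bfs 1<bound source out (2 * k)) λ y layered →
      let open Layers y layered in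
      achieves->>= (k + T) _ (achieves-convergecast (k + T)) λ z totals →
      let open Choice z totals in
      achieves->>= T 0 (achieves-flood ⊔-isSelection T candidate candidate<bound) λ j flooded →
      achieves-return _ (cover , (λ v → cong just (trans
        (cong (inCover (left v) (level v)) (chosen j flooded v))
        (sym (lookup∘tabulate (inside best) v)))) , cover-approximate)

  achieves-idle : ∀ L → Achieves L (λ v → idle {degree v} L) (λ a → ∀ v → a v ≡ nothing)
  achieves-idle L = achieves-iterate (λ _ a → ∀ v → a v ≡ nothing)
    (λ _ _ _ v p → ≤-<-trans z≤n (n<bound v p)) (λ _ _ none _ _ → none) L _ (λ _ → refl)

  achieves-phase : ∀ T → Achieves (phaseRounds k T) (λ v → phase k (input v) T)
    (λ a → Covers a ⊎ (∀ v → a v ≡ nothing) × T < D)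
  achieves-phase T =
    achieves->>= T _ (achieves-flood ⊓-isSelection T ident λ _ _ → ident<bound) λ label labels →
    let label< = flooded-bound {_≤_} labels ident<bound in
    achieves->>= (suc (2 * T)) _ (achieves-flood ⊔-isSelection (suc (2 * T)) label λ _ _ → label<) λ high highs →
    achieves->>= (suc (2 * T)) _ (achieves-flood ⊓-isSelection (suc (2 * T)) label λ _ _ → label<) λ low lows →
    decide label high low (Election.decision T labels highs lows)
    where
    Outcome : (Fin n → Maybe Bool) → Set
    Outcome a = Covers a ⊎ (∀ v → a v ≡ nothing) × T < D

    decide : ∀ label high low →
      Elected T label × (∀ v → high v ≡ low v) ⊎ (∀ v → high v ≢ low v) × T < D →
      Achieves (coverRounds k T)
        (λ v → if does (high v ≟ low v) then coverProgram k (input v) T (label v) else idle (coverRounds k T))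
        Outcome
    decide label high low (inj₁ (e , eq)) = achieves-cong (coverRounds k T)
      (λ v → cong (if_then coverProgram k (input v) T (label v) else idle (coverRounds k T))
               (dec-true (high v ≟ low v) (eq v)))
      (achieves-weaken (coverRounds k T) (λ _ → inj₁) (CoverStage.achieves-cover T label e))
    decide label high low (inj₂ (neq , T<D)) = achieves-cong (coverRounds k T)
      (λ v → cong (if_then coverProgram k (input v) T (label v) else idle (coverRounds k T))
               (dec-false (high v ≟ low v) (neq v)))
      (achieves-weaken (coverRounds k T) (λ _ none → inj₂ (none , T<D)) (achieves-idle (coverRounds k T)))

  -- The doubling search

  open PhaseExecution phase k P input B
  open Execution (repeatPhases phase) k P input

  2*-double : ∀ m → 2 * m ≡ m + m
  2*-double m = cong (λ j → m + j) (+-identityʳ m)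

  -- With the round that doubles the guess, a phase costs 8T + 3k + 3 rounds. Both k and 1 are at
  -- most T, whence 14 = 8 + 3 + 3.
  phaseRounds-≤ : ∀ T → k ≤ T → suc (phaseRounds k T) ≤ 14 * T
  phaseRounds-≤ T k≤T = begin
    suc (phaseRounds k T)     ≡⟨ solve 2 (λ k T → con 1 :+ (T :+ ((con 1 :+ con 2 :* T) :+ ((con 1 :+ con 2 :* T) :+
                                   (T :+ (con 2 :* k :+ ((k :+ T) :+ (T :+ con 0)))))))
                                   := con 8 :* T :+ (con 3 :* k :+ con 3)) refl k T ⟩
    8 * T + (3 * k + 3 * 1)   ≤⟨ +-monoʳ-≤ (8 * T) (+-mono-≤ (*-monoʳ-≤ 3 k≤T)
                                   (*-monoʳ-≤ 3 (≤-trans (>-nonZero⁻¹ k) k≤T))) ⟩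
    8 * T + (3 * T + 3 * T)   ≡⟨ solve 1 (λ T → con 8 :* T :+ (con 3 :* T :+ con 3 :* T) := con 14 :* T) refl T ⟩
    14 * T                    ∎
    where
    open ≤-Reasoning

  -- The phases before the guess T take at most 14 (T - k) rounds.
  search : ∀ fuel T t → D ≤ T + fuel → k ≤ T → T ≤ 2 * D + k → t + 14 * k ≤ 14 * T →
    BoundedBefore t → Running t T (λ v → phase k (input v) T) →
    MessagesBounded B × (∃[ t ] ∃[ S ] t ≤ 56 * (D + k) × ComputesWithin t S ×
                         IsApproximateVertexCover G′ (1ℚ ℚ.+ + 1 / k) S)
  search fuel T t D≤ k≤T T≤ t≤ before running
    with run t T (phaseRounds k T) _ before running (achieves-phase T)
  ... | before′ , a , inj₁ (S , eq , approximate) , running′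
    with finish (lookup S) eq before′ running′
  ...   | bounded , computed = bounded , t + phaseRounds k T , S , rounds , computed , approximate
    where
    -- At most 14T rounds before the last phase, at most 14T in it, and T ≤ 2 (D + k): this gives
    -- 56.
    rounds : t + phaseRounds k T ≤ 56 * (D + k)
    rounds = begin
      t + phaseRounds k T    ≤⟨ +-mono-≤ (≤-trans (m≤m+n t (14 * k)) t≤) (≤-trans (n≤1+n _) (phaseRounds-≤ T k≤T)) ⟩
      14 * T + 14 * T        ≤⟨ +-mono-≤ (*-monoʳ-≤ 14 T≤′) (*-monoʳ-≤ 14 T≤′) ⟩
      14 * (2 * (D + k)) + 14 * (2 * (D + k))
        ≡⟨ solve 1 (λ m → con 14 :* (con 2 :* m) :+ con 14 :* (con 2 :* m) := con 56 :* m) refl (D + k) ⟩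
      56 * (D + k)           ∎
      where
      open ≤-Reasoning
      T≤′ : T ≤ 2 * (D + k)
      T≤′ = ≤-trans T≤ (≤-trans (+-monoʳ-≤ (2 * D) (m≤m+n k (k + 0))) (≤-reflexive (sym (*-distribˡ-+ 2 D k))))
  search zero T t D≤ k≤T T≤ t≤ before running
    | _ , _ , inj₂ (_ , T<D) , _ = contradiction (≤-trans D≤ (≤-reflexive (+-identityʳ T))) (<⇒≱ T<D)
  search (suc fuel) T t D≤ k≤T T≤ t≤ before running
    | before′ , a , inj₂ (none , T<D) , running′ with retry none before′ running′
  ...   | before″ , running″ =
    search fuel (2 * T) (suc (t + phaseRounds k T)) D≤′ (≤-trans k≤T (m≤m+n T _))
      -- Only a failed guess is doubled, and failure implies T < D.
      (≤-trans (*-monoʳ-≤ 2 (<⇒≤ T<D)) (m≤m+n _ k)) t≤′ before″ running″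
    where
    open ≤-Reasoning
    D≤′ : D ≤ 2 * T + fuel
    -- `fuel` bounds D - T from above; doubling raises T by at least 1, since 1 ≤ k ≤ T.
    D≤′ = begin
      D               ≤⟨ D≤ ⟩
      T + (1 + fuel)  ≤⟨ +-monoʳ-≤ T (+-monoˡ-≤ fuel (≤-trans (>-nonZero⁻¹ k) k≤T)) ⟩
      T + (T + fuel)  ≡⟨ +-assoc T T fuel ⟨
      T + T + fuel    ≡⟨ cong (_+ fuel) (2*-double T) ⟨
      2 * T + fuel    ∎
    t≤′ : suc (t + phaseRounds k T) + 14 * k ≤ 14 * (2 * T)
    t≤′ = begin
      suc (t + phaseRounds k T) + 14 * k
        ≡⟨ solve 3 (λ t r k → con 1 :+ (t :+ r) :+ k := (t :+ k) :+ (con 1 :+ r)) refl t (phaseRounds k T) (14 * k) ⟩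
      (t + 14 * k) + suc (phaseRounds k T) ≤⟨ +-mono-≤ t≤ (phaseRounds-≤ T k≤T) ⟩
      14 * T + 14 * T                      ≡⟨ *-distribˡ-+ 14 T T ⟨
      14 * (T + T)                         ≡⟨ cong (14 *_) (2*-double T) ⟨
      14 * (2 * T)                         ∎

lemma3p1 : ∀ (c : ℕ) → Σ Algorithm λ A → ∃[ B ] ∃[ C ]
    ( ∀ {n} (G : Graph n) → Bipartite G → ∀ D → Diameter G D →
    ∀ (G′ : Subgraph G) (k : ℕ) .{{_ : NonZero k}} →
    ∀ (M : EdgeSet n) → IsMatching G′ M →
    (∀ ℓ → ℓ ≤ 2 * k ∸ 1 → ¬ AugmentingPath M (edges G′) ℓ) →
    ∀ (P : Ports G) (ids : Identifiers c n) →
    let open Execution A k P (nodeInput P ids G′ M) in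
    MessagesBounded (B * ⌈log₂ n ⌉) ×
    (∃[ t ] ∃[ S ]
    t ≤ C * (D + k) ×
    ComputesWithin t S ×
    IsApproximateVertexCover G′ (1ℚ ℚ.+ + 1 / k) S) )
lemma3p1 c = repeatPhases phase , c + 2 , 56 ,
  λ G bipartite D diameter G′ k M matching no-augmenting P ids →
  let open Correctness c G bipartite D diameter G′ k M matching no-augmenting P ids in
  -- The first guess is k, at round 0, and D failures are more than enough fuel.
  search D k 0 (m≤n+m D k) ≤-refl (m≤n+m k (2 * D)) ≤-refl (λ _ ()) (λ _ → refl)
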